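{- Let $\Delta,k$ be integers with $k\ge 1$, $\Delta\ge k+2$ and $\Delta$ odd. Then there is a gadget, i.e. a realizable instance of $\Delta$-$k$-DiTTR (so that $D_{u,v}\ge\hat d(u,v)+k$ for all $u,v$), that enforces $\lambda(v_1,v_2)=\lambda(v_2,v_1)$ for some pair of adjacent vertices $(v_1,v_2)$.
   Context: All graphs are finite. A $\Delta$-periodic labeling of a directed graph $G=(V,E)$ is a map $\lambda:E\to\{0,1,\dots,\Delta-1\}$; edge $e$ is then active exactly at the times $\lambda(e)+i\Delta$, $i\in\mathbb{N}_0$. A temporal $s$-$z$-path is a sequence $(v_{i-1},v_i,t_i)_{i=1}^{\ell}$ with $v_0=s$, $v_\ell=z$, pairwise distinct vertices $v_0,\dots,v_\ell$, $(v_{i-1},v_i)\in E$ active at time $t_i$ for every $i$, and $t_1<t_2<\dots<t_\ell$ (strictly increasing). Its duration is $t_\ell+1-t_1$. A fastest temporal path is one of minimum duration. $\hat d(u,v)$ is the distance from $u$ to $v$ in the static graph $G$ (all edges have unit length). A bidirected tree is the directed graph obtained from an undirected tree by replacing each edge $\{u,v\}$ by the two directed edges $(u,v),(v,u)$ (which may get different labels). For integers $\Delta\ge1,k\ge0$, an instance of $\Delta$-$k$-DiTTR consists of a bidirected tree $G=(V,E)$ and a matrix $D$ indexed by $V\times V$ with entries positive integers or $\infty$ (no restriction) such that $D_{u,v}\ge\hat d(u,v)+k$ for all $u,v$. A valid labeling is a $\Delta$-periodic labeling $\lambda$ of $E$ such that, for all $u,v\in V$, the duration of a fastest temporal path from $u$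 to $v$ is at most $D_{u,v}$; the instance is realizable if a valid labeling exists. Diagonal entries of $D$ play no role; all conditions on $D$ are for distinct vertices. An instance enforces $\lambda(v_1,v_2)=\lambda(v_2,v_1)$ if this equality holds for every valid labeling $\lambda$. -}

module Defs where

open import Data.Bool using (Bool; T)
open import Data.Fin using (Fin; zero; suc; inject₁; fromℕ; toℕ)
import Data.Fin as Fin
open import Data.Nat using (ℕ; suc; _+_; _*_; _∸_; _≤_; _<_)
open import Data.Product using (_×_; _,_; ∃; ∃₂; ∃-syntax)
open import Function.Definitions using (Injective)
open import Relation.Binary.Construct.Add.Supremum.NonStrict _≤_ using (_≤⁺_)
open import Relation.Binary.Core using (_Preserves_⟶_)
open import Relation.Binary.Definitions using (Irreflexive; Symmetric)
open import Relation.Binary.PropositionalEquality using (_≡_; _≢_)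
open import Relation.Nullary using (¬_)
open import Relation.Nullary.Construct.Add.Supremum using (_⁺; [_])

record Digraph : Set where
  field
    order : ℕ
    arc   : Fin order → Fin order → Bool

  V : Set
  V = Fin order

  -- Arcs are given by a Boolean matrix so that `Arc u v` has at most one
  -- inhabitant: parallel arcs are impossible and an element of `E` is
  -- determined by its endpoints.
  Arc : V → V → Set
  Arc u v = T (arc u v)

  E : Set
  E = ∃₂ Arc

  record Path (s z : V) (ℓ : ℕ) : Set where
    field
      vertex   : Fin (suc ℓ) → V
      start    : vertex zero ≡ s
      end      : vertex (fromℕ ℓ) ≡ z
      distinct : Injective _≡_ _≡_ vertex
      isArc    : ∀ i → Arc (vertex (inject₁ i)) (vertex (suc i))

    edge : Fin ℓ → E
    edge i = vertex (inject₁ i) , vertex (suc i) , isArc i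

  IsDistance : V → V → ℕ → Set
  IsDistance u v d = Path u v d × (∀ {ℓ} → Path u v ℓ → d ≤ ℓ)

  -- The bidirected trees are exactly the symmetric irreflexive digraphs whose
  -- underlying undirected graph is a tree.  The bound 2 ≤ ℓ in `acyclic` is
  -- there because an arc together with its reverse is a single undirected edge
  -- and not a cycle.
  record IsBidirectedTree : Set where
    field
      symmetric   : Symmetric Arc
      irreflexive : Irreflexive _≡_ Arc
      nonempty    : V
      connected   : ∀ u v → ∃[ ℓ ] Path u v ℓ
      acyclic     : ∀ {u v ℓ} → 2 ≤ ℓ → Path u v ℓ → ¬ Arc v u

  Labeling : ℕ → Set
  Labeling Δ = E → Fin Δ

  module _ {Δ : ℕ} (lab : Labeling Δ) where

    ActiveAt : E → ℕ → Set
    ActiveAt e t = ∃[ i ] t ≡ toℕ (lab e) + i * Δ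

    -- The path has suc m ≥ 1 edges, since the duration of an empty path is not
    -- defined.  As the vertices are distinct, this forces s ≢ z.
    record TemporalPath (s z : V) : Set where
      field
        m          : ℕ
        path       : Path s z (suc m)
        time       : Fin (suc m) → ℕ
        active     : ∀ i → ActiveAt (Path.edge path i) (time i)
        increasing : time Preserves Fin._<_ ⟶ _<_

      duration : ℕ
      duration = time (fromℕ m) + 1 ∸ time zero

    open TemporalPath using (duration)

    IsFastest : ∀ {s z} → TemporalPath s z → Set
    IsFastest {s} {z} p = ∀ (q : TemporalPath s z) → duration p ≤ duration q

-- Upper bounds on durations lie in ℕ ⁺, with ⊤⁺ in the role of ∞.
-- The period Δ does not constrain the data of an instance; it fixes which
-- labelings are considered.
record DiTTR (Δ k : ℕ) : Set where
  field
    graph    : Digraph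
  open Digraph graph public
  field
    isTree   : IsBidirectedTree
    D        : V → V → ℕ ⁺
    positive : ∀ u v → [ 1 ] ≤⁺ D u v
    slack    : ∀ {u v} → u ≢ v → ∃[ d ] IsDistance u v d × [ d + k ] ≤⁺ D u v

  open IsBidirectedTree isTree public

  Valid : Labeling Δ → Set
  Valid lab = ∀ {u v} → u ≢ v →
    ∃[ p ] IsFastest lab {u} {v} p × [ TemporalPath.duration p ] ≤⁺ D u v

  Realizable : Set
  Realizable = ∃[ lab ] Valid lab

  EnforcesEqual : E → E → Set
  EnforcesEqual e f = ∀ lab → Valid lab → lab e ≡ lab f

{-# OPTIONS --safe #-}

-- On the comb (a spine with one tine at every spine vertex) a tree path is
-- unique, so a fastest path from u to v lasts dist u v + (waiting), where the
-- waiting is the sum over consecutive arcs of λ(next) − λ(previous) − 1 mod Δ.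
-- The bound D u v is dist u v + max(k, waiting of an intended labelling λ₀); so
-- λ₀ is valid, and in a valid labelling the waiting between two tines is at most
-- k whenever it is at most k under λ₀.  Tines with such bounds are called hubs.
--
-- The turn at spine position i is λ(i, i+1) − λ(i+1, i) − 1 mod Δ.  It is what
-- the two directions of the spine have gained on each other, so without
-- superfluous waiting it grows by 2 per position, that is, by 1 per (Δ+1)/2
-- positions since Δ is odd; λ₀ has turn 2i − 1.  In each direction of
-- the spine, a turn c > 0 at a hub costs waiting c on paths between the tine and
-- the part of the spine ahead of it, or else waiting Δ − c on the other side.
-- The spine has k+1 long blocks, and block b has its hubs where the turn of λ₀
-- lies in {b−k, …, b} mod Δ.  Between its ends only 2k units of waiting are
-- available, so each block contains a stretch without any.  There, k+1 hubs with
-- consecutive turns leave only one possibility: the turns are h−k, …, h for a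
-- height h between 0 and k.  Comparing waiting and turns across two successive
-- blocks shows that the height rises by 1 + (waiting in between).  Hence it rises
-- by exactly 1 from 0 to k, nothing is wasted, and the turn at the boundary of
-- the first two blocks is −1 mod Δ: the two labels there agree.
module Submission where

open import Defs
open import Data.Bool.Properties using (T?; T-irrelevant)
open import Data.Fin using (Fin; zero; suc; inject₁; fromℕ; fromℕ<; toℕ; combine; remQuot)
open import Data.Fin.Patterns using (0F; 1F)
import Data.Fin.Properties as Fin
open import Data.Nat
open import Data.Nat.DivMod
open import Data.Nat.Divisibility using (_∤_; m%n≡0⇒n∣m)
open import Data.Nat.Properties
open import Data.Nat.Tactic.RingSolver using (solve-∀)
open import Data.Product using (Σ-syntax; ∃-syntax; ∃₂; _×_; _,_; proj₁; proj₂; uncurry)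
open import Data.Sum using (_⊎_; inj₁; inj₂)
open import Relation.Binary.Construct.Add.Supremum.NonStrict _≤_ using ([_])
open import Relation.Binary.Definitions using (Irreflexive; Symmetric; tri<; tri≈; tri>)
open import Relation.Binary.PropositionalEquality hiding ([_])
open import Relation.Nullary using (¬_; Dec; yes; no; contradiction)
open import Relation.Nullary.Construct.Add.Supremum using () renaming ([_] to ⌈_⌉)
open import Relation.Nullary.Decidable using (⌊_⌋; toWitness; fromWitness)

-- Finite sums and congruences

Sum : (ℕ → ℕ) → ℕ → ℕ → ℕ
Sum f p zero    = 0
Sum f p (suc n) = Sum f p n + f (p + n)

Sum-+ : ∀ f p m n → Sum f p (m + n) ≡ Sum f p m + Sum f (p + m) n
Sum-+ f p m zero = trans (cong (Sum f p) (+-identityʳ m)) (sym (+-identityʳ _))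
Sum-+ f p m (suc n) = begin
  Sum f p (m + suc n)                             ≡⟨ cong (Sum f p) (+-suc m n) ⟩
  Sum f p (m + n) + f (p + (m + n))               ≡⟨ cong₂ _+_ (Sum-+ f p m n)
    (cong f (sym (+-assoc p m n))) ⟩
  Sum f p m + Sum f (p + m) n + f (p + m + n)     ≡⟨ +-assoc (Sum f p m) _ _ ⟩
  Sum f p m + (Sum f (p + m) n + f (p + m + n))   ∎
  where open ≡-Reasoning

Sum-head : ∀ f p n → Sum f p (suc n) ≡ f p + Sum f (suc p) n
Sum-head f p n = begin
  Sum f p (1 + n)                   ≡⟨ Sum-+ f p 1 n ⟩
  f (p + 0) + Sum f (p + 1) n       ≡⟨ cong₂ (λ i j → f i + Sum f j n) (+-identityʳ p) (+-comm p 1) ⟩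
  f p + Sum f (suc p) n             ∎
  where open ≡-Reasoning

Sum-cong : ∀ {f g} p q n → (∀ l → l < n → f (p + l) ≡ g (q + l)) → Sum f p n ≡ Sum g q n
Sum-cong p q zero    f≗g = refl
Sum-cong p q (suc n) f≗g =
  cong₂ _+_ (Sum-cong p q n λ l l<n → f≗g l (m<n⇒m<1+n l<n)) (f≗g n ≤-refl)

Sum-reverse : ∀ {f g} p q n → (∀ l m → suc (l + m) ≡ n → f (p + l) ≡ g (q + m)) →
              Sum f p n ≡ Sum g q n
Sum-reverse p q zero f≗g = refl
Sum-reverse {f} {g} p q (suc n) f≗g = begin
  Sum f p n + f (p + n)      ≡⟨ cong₂ _+_ (Sum-reverse p (suc q) n shifted)
    (f≗g n 0 (cong suc (+-identityʳ n))) ⟩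
  Sum g (suc q) n + g (q + 0) ≡⟨ cong (λ i → Sum g (suc q) n + g i) (+-identityʳ q) ⟩
  Sum g (suc q) n + g q      ≡⟨ +-comm (Sum g (suc q) n) (g q) ⟩
  g q + Sum g (suc q) n      ≡⟨ Sum-head g q n ⟨
  Sum g q (suc n)            ∎
  where
  open ≡-Reasoning
  shifted : ∀ l m → suc (l + m) ≡ n → f (p + l) ≡ g (suc q + m)
  shifted l m eq = trans (f≗g l (suc m) (cong suc (trans (+-suc l m) eq))) (cong g (+-suc q m))

Sum-zero : ∀ {f} p n → (∀ l → l < n → f (p + l) ≡ 0) → Sum f p n ≡ 0
Sum-zero p zero    f≗0 = refl
Sum-zero p (suc n) f≗0 =
  cong₂ _+_ (Sum-zero p n λ l l<n → f≗0 l (m<n⇒m<1+n l<n)) (f≗0 n ≤-refl)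

Sum≡0⇒term≡0 : ∀ f p n → Sum f p n ≡ 0 → ∀ l → l < n → f (p + l) ≡ 0
Sum≡0⇒term≡0 f p (suc n) eq l l<1+n with m≤n⇒m<n∨m≡n (s≤s⁻¹ l<1+n)
... | inj₁ l<n  = Sum≡0⇒term≡0 f p n (m+n≡0⇒m≡0 _ eq) l l<n
... | inj₂ refl = m+n≡0⇒n≡0 (Sum f p n) eq

Sum-distrib : ∀ f g p n → Sum (λ i → f i + g i) p n ≡ Sum f p n + Sum g p n
Sum-distrib f g p zero    = refl
Sum-distrib f g p (suc n) =
  trans (cong (_+ (f (p + n) + g (p + n))) (Sum-distrib f g p n))
    (interchange (Sum f p n) (Sum g p n) (f (p + n)) (g (p + n)))
  where
  interchange : ∀ a b c d → (a + b) + (c + d) ≡ (a + c) + (b + d)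
  interchange = solve-∀

Sum-monoʳ : ∀ f p {m n} → m ≤ n → Sum f p m ≤ Sum f p n
Sum-monoʳ f p {m} m≤n with k , refl ← m≤n⇒∃[o]m+o≡n m≤n =
  ≤-trans (m≤m+n _ _) (≤-reflexive (sym (Sum-+ f p m k)))

zero-run : ∀ f L m p → Sum f p (suc m * L) ≤ m →
           ∃[ q ] p ≤ q × q + L ≤ p + suc m * L × (∀ l → l < L → f (q + l) ≡ 0)
zero-run f L m p Σ≤m with Sum f p L in eq
... | zero = p , ≤-refl , +-monoʳ-≤ p (m≤m+n L (m * L)) , Sum≡0⇒term≡0 f p L eq
... | suc c with m
...   | zero = contradiction (subst (_≤ 0) Σ≡1+c Σ≤m) λ ()
  where
  Σ≡1+c : Sum f p (1 * L) ≡ suc c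
  Σ≡1+c = trans (cong (Sum f p) (+-identityʳ L)) eq
...   | suc m′ = let (q , p+L≤q , q+L≤ , run) = zero-run f L m′ (p + L) rest in
  q , ≤-trans (m≤m+n p L) p+L≤q , ≤-trans q+L≤ (≤-reflexive (+-assoc p L (suc m′ * L))) , run
  where
  rest : Sum f (p + L) (suc m′ * L) ≤ m′
  rest = s≤s⁻¹ (≤-trans (s≤s (m≤n+m _ c)) (≤-trans (≤-reflexive
    (trans (cong (_+ Sum f (p + L) (suc m′ * L)) (sym eq)) (sym (Sum-+ f p L (suc m′ * L))))) Σ≤m))

module Congruence (δ : ℕ) where

  infix 4 _≋_
  record _≋_ (a b : ℕ) : Set where
    constructor ≋-intro
    field ≋⇒%≡ : a % suc δ ≡ b % suc δ
  open _≋_ public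

  ≋-refl : ∀ {a} → a ≋ a
  ≋-refl = ≋-intro refl

  ≋-reflexive : ∀ {a b} → a ≡ b → a ≋ b
  ≋-reflexive refl = ≋-refl

  ≋-sym : ∀ {a b} → a ≋ b → b ≋ a
  ≋-sym (≋-intro e) = ≋-intro (sym e)

  ≋-trans : ∀ {a b c} → a ≋ b → b ≋ c → a ≋ c
  ≋-trans (≋-intro e) (≋-intro f) = ≋-intro (trans e f)

  infixl 6 _⊕_
  _⊕_ : ∀ {a b c d} → a ≋ b → c ≋ d → a + c ≋ b + d
  _⊕_ {a} {b} {c} {d} (≋-intro e) (≋-intro f) = ≋-intro (begin
    (a + c) % suc δ                      ≡⟨ %-distribˡ-+ a c (suc δ) ⟩
    (a % suc δ + c % suc δ) % suc δ      ≡⟨ cong₂ (λ i j → (i + j) % suc δ) e f ⟩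
    (b % suc δ + d % suc δ) % suc δ      ≡⟨ %-distribˡ-+ b d (suc δ) ⟨
    (b + d) % suc δ                      ∎)
    where open ≡-Reasoning

  ≋-*ˡ : ∀ c {a b} → a ≋ b → c * a ≋ c * b
  ≋-*ˡ zero    e = ≋-refl
  ≋-*ˡ (suc c) e = e ⊕ ≋-*ˡ c e

  +-period : ∀ a c → a + c * suc δ ≋ a
  +-period a c = ≋-intro ([m+kn]%n≡m%n a c (suc δ))

  %-≋ : ∀ a → a % suc δ ≋ a
  %-≋ a = ≋-intro (m%n%n≡m%n a (suc δ))

  ≋⇒≡ : ∀ {a b} → a ≤ δ → b ≤ δ → a ≋ b → a ≡ b
  ≋⇒≡ a≤δ b≤δ (≋-intro e) = trans (sym (m≤n⇒m%n≡m a≤δ)) (trans e (m≤n⇒m%n≡m b≤δ))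

  +-cancelˡ-≋ : ∀ c {a b} → c + a ≋ c + b → a ≋ b
  +-cancelˡ-≋ c {a} {b} e = ≋-trans (≋-sym (absorb a)) (≋-trans (≋-refl {c * δ} ⊕ e) (absorb b))
    where
    reorder : ∀ c d a → c * d + (c + a) ≡ a + c * suc d
    reorder = solve-∀
    absorb : ∀ a → c * δ + (c + a) ≋ a
    absorb a = ≋-trans (≋-reflexive (reorder c δ a)) (+-period a c)

  ≋-by : ∀ {a b x y} → a ≋ b → b + x ≡ a + y → x ≋ y
  ≋-by {a} {b} {x} {y} e eq = +-cancelˡ-≋ b (≋-trans (≋-reflexive eq) (e ⊕ ≋-refl {y}))

  wait : ℕ → ℕ → ℕ
  wait a b = (b + (δ ∸ a)) % suc δ

  wait≤δ : ∀ a b → wait a b ≤ δ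
  wait≤δ a b = s≤s⁻¹ (m%n<n (b + (δ ∸ a)) (suc δ))

  wait-≋ : ∀ {a} b → a ≤ δ → suc (a + wait a b) ≋ b
  wait-≋ {a} b a≤δ = ≋-trans (≋-refl {suc a} ⊕ %-≋ (b + (δ ∸ a)))
    (≋-trans (≋-reflexive (trans (reorder a b (δ ∸ a))
      (cong (λ i → b + 1 * suc i) (m+[n∸m]≡n a≤δ)))) (+-period b 1))
    where
    reorder : ∀ a b d → suc a + (b + d) ≡ b + 1 * suc (a + d)
    reorder = solve-∀

  wait-unique : ∀ {a b c} → a ≤ δ → c ≤ δ → suc (a + c) ≋ b → wait a b ≡ c
  wait-unique {a} {b} a≤δ c≤δ e =
    ≋⇒≡ (wait≤δ a b) c≤δ (+-cancelˡ-≋ (suc a) (≋-trans (wait-≋ b a≤δ) (≋-sym e)))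

  wait-minimal : ∀ {a b t u} → a ≤ δ → t ≋ a → u ≋ b → t < u → t + suc (wait a b) ≤ u
  wait-minimal {a} {b} {t} {u} a≤δ t≋a u≋b t<u with c , refl ← m≤n⇒∃[o]m+o≡n t<u =
    ≤-trans (≤-reflexive (+-suc t _)) (+-monoʳ-≤ (suc t) (begin
      wait a b       ≡⟨ m≤n⇒m%n≡m (wait≤δ a b) ⟨
      wait a b % suc δ ≡⟨ ≋⇒%≡ (+-cancelˡ-≋ (suc a)
        (≋-trans (wait-≋ b a≤δ) (≋-trans (≋-sym u≋b) (≋-refl {1} ⊕ t≋a ⊕ ≋-refl {c})))) ⟩
      c % suc δ      ≤⟨ m%n≤m c (suc δ) ⟩
      c              ∎))
    where open ≤-Reasoning

-- Hubs along a stretch without waiting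

-- Rungs are consecutive hubs on a stretch of the spine without superfluous
-- waiting.  `turn + m` is the turn at rung m, and the four families are the
-- waits between the spine and the tine of the rung.
record Ladder (δ k : ℕ) : Set where
  open Congruence δ
  field
    k<δ  : k < δ
    turn : ℕ
    exit-forth exit-back enter-forth enter-back : ℕ → ℕ
    exit-forth≤k  : ∀ {m} → m ≤ k → exit-forth m ≤ k
    exit-back≤k   : ∀ {m} → m ≤ k → exit-back m ≤ k
    enter-forth≤k : ∀ {m} → m ≤ k → enter-forth m ≤ k
    enter-back≤k  : ∀ {m} → m ≤ k → enter-back m ≤ k
    exit-turn     : ∀ {m} → m ≤ k → exit-forth m + (turn + m) ≋ exit-back m
    enter-turn    : ∀ {m} → m ≤ k → enter-back m + (turn + m) ≋ enter-forth m
    forth-budget  : ∀ {m} → suc m ≤ k → enter-forth m + exit-forth (suc m) ≤ k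
    back-budget   : ∀ {m} → suc m ≤ k → exit-back m + enter-back (suc m) ≤ k

  private
    lift : ∀ {m c a b} → turn + m ≋ c → a + c ≤ k → b ≤ k → a + (turn + suc m) ≋ b → b ≡ a + suc c
    lift {m} {c} {a} {b} v≋c a+c≤k b≤k e =
      ≋⇒≡ (≤-trans b≤k (<⇒≤ k<δ)) (≤-trans (≤-reflexive (+-suc a c)) (≤-trans (s≤s a+c≤k) k<δ))
        (≋-sym (≋-by (e ⊕ ≋-sym v≋c) (regroup a b c turn m)))
      where
      regroup : ∀ a b c v m → b + (v + m) + (a + suc c) ≡ a + (v + suc m) + c + b
      regroup = solve-∀

    step-enter : ∀ {m c} → suc m ≤ k → turn + m ≋ c → c ≤ exit-back m → suc c ≤ enter-forth (suc m)
    step-enter {m} {c} m<k v≋c c≤ = ≤-trans (m≤n+m (suc c) _) (≤-reflexive (sym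
      (lift v≋c (≤-trans (≤-reflexive (+-comm _ c)) (≤-trans (+-monoˡ-≤ _ c≤) (back-budget m<k)))
        (enter-forth≤k m<k) (enter-turn m<k))))

    step-exit : ∀ {m c} → suc m ≤ k → turn + m ≋ c → c ≤ enter-forth m → suc c ≤ exit-back (suc m)
    step-exit {m} {c} m<k v≋c c≤ = ≤-trans (m≤n+m (suc c) _) (≤-reflexive (sym
      (lift v≋c (≤-trans (≤-reflexive (+-comm _ c)) (≤-trans (+-monoˡ-≤ _ c≤) (forth-budget m<k)))
        (exit-back≤k m<k) (exit-turn m<k))))

    turn-suc : ∀ {m c} → turn + m ≋ c → turn + suc m ≋ suc c
    turn-suc {m} {c} v≋c = ≋-trans (≋-reflexive (+-suc turn m)) (≋-refl {1} ⊕ v≋c)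

    climb-either : ∀ n {m c} → m + n ≤ k → turn + m ≋ c →
                   c ≤ exit-back m ⊎ c ≤ enter-forth m → c + n ≤ k
    climb-either zero {m} {c} m≤k v≋c (inj₁ c≤) = subst (_≤ k) (sym (+-identityʳ c))
      (≤-trans c≤ (exit-back≤k (≤-trans (m≤m+n m 0) m≤k)))
    climb-either zero {m} {c} m≤k v≋c (inj₂ c≤) = subst (_≤ k) (sym (+-identityʳ c))
      (≤-trans c≤ (enter-forth≤k (≤-trans (m≤m+n m 0) m≤k)))
    climb-either (suc n) {m} {c} m+n≤k v≋c h =
      subst (_≤ k) (sym (+-suc c n)) (climb-either n 1+m+n≤k (turn-suc v≋c) (next h))
      where
      1+m+n≤k : suc m + n ≤ k
      1+m+n≤k = subst (_≤ k) (+-suc m n) m+n≤k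
      m<k : suc m ≤ k
      m<k = ≤-trans (m≤m+n (suc m) n) 1+m+n≤k
      next : c ≤ exit-back m ⊎ c ≤ enter-forth m → suc c ≤ exit-back (suc m) ⊎ suc c ≤ enter-forth
        (suc m)
      next (inj₁ c≤) = inj₂ (step-enter m<k v≋c c≤)
      next (inj₂ c≤) = inj₁ (step-exit m<k v≋c c≤)

    climb-both : ∀ n {m c} → m + n ≤ k → turn + m ≋ c → c ≤ exit-back m × c ≤ enter-forth m →
                 c + n ≤ exit-back (m + n) × c + n ≤ enter-forth (m + n)
    climb-both zero {m} {c} m≤k v≋c h rewrite +-identityʳ m | +-identityʳ c = h
    climb-both (suc n) {m} {c} m+n≤k v≋c (c≤ , c≤′) rewrite +-suc m n | +-suc c n =
      climb-both n m+n≤k (turn-suc v≋c) (step-exit m<k v≋c c≤′ , step-enter m<k v≋c c≤)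
      where
      m<k : suc m ≤ k
      m<k = ≤-trans (m≤m+n (suc m) n) m+n≤k

    -- A positive turn at the bottom rung would exceed k at the top.
    descend : ∀ {a b} → a + (turn + 0) ≋ b → b ≤ exit-back 0 ⊎ b ≤ enter-forth 0 →
              ∃[ q ] q + b ≡ a × q + turn ≋ 0
    descend {a} {b} e b≤ with a <? b
    ... | yes a<b with c , refl ← m≤n⇒∃[o]m+o≡n a<b =
      contradiction (climb-either k ≤-refl v≋c (shrink b≤)) λ le → <⇒≱ (s≤s (m≤n+m k c)) le
      where
      regroup : ∀ a v c → suc a + c + v ≡ a + v + suc c
      regroup = solve-∀
      v≋c : turn + 0 ≋ suc c
      v≋c = ≋-by e (regroup a (turn + 0) c)
      1+c≤b : suc c ≤ suc (a + c)
      1+c≤b = s≤s (m≤n+m c a)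
      shrink : suc a + c ≤ exit-back 0 ⊎ suc a + c ≤ enter-forth 0 →
               suc c ≤ exit-back 0 ⊎ suc c ≤ enter-forth 0
      shrink (inj₁ h) = inj₁ (≤-trans 1+c≤b h)
      shrink (inj₂ h) = inj₂ (≤-trans 1+c≤b h)
    ... | no a≮b with q , refl ← m≤n⇒∃[o]m+o≡n (≮⇒≥ a≮b) =
      q , +-comm q b , ≋-by e (regroup b q turn)
      where
      regroup : ∀ b q v → b + (q + v) ≡ b + q + (v + 0) + 0
      regroup = solve-∀

  ladder-height : ∃₂ λ q c → q + c ≡ k × q + turn ≋ 0 ×
                  q ≤ exit-forth 0 × q ≤ enter-back 0 × c ≤ exit-back k × c ≤ enter-forth k
  ladder-height
    with (q , q+b≡a , q+v≋0) ← descend (exit-turn z≤n) (inj₁ ≤-refl)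
       | (q′ , q′+b≡a , q′+v≋0) ← descend (enter-turn z≤n) (inj₂ ≤-refl)
    = q , k ∸ q , m+[n∸m]≡n q≤k , q+v≋0 , q≤exit
    , subst (_≤ enter-back 0) (sym q≡q′) q′≤enter
    , proj₁ (top (k ∸ q) (m+[n∸m]≡n q≤k)) , proj₂ (top (k ∸ q) (m+[n∸m]≡n q≤k))
    where
    q≤exit : q ≤ exit-forth 0
    q≤exit = subst (q ≤_) q+b≡a (m≤m+n q _)
    q′≤enter : q′ ≤ enter-back 0
    q′≤enter = subst (q′ ≤_) q′+b≡a (m≤m+n q′ _)
    q≤k : q ≤ k
    q≤k = ≤-trans q≤exit (exit-forth≤k z≤n)
    q≡q′ : q ≡ q′
    q≡q′ = ≋⇒≡ (≤-trans q≤k (<⇒≤ k<δ)) (≤-trans q′≤enter (≤-trans (enter-back≤k z≤n) (<⇒≤ k<δ)))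
      (≋-by (q+v≋0 ⊕ ≋-sym q′+v≋0) (regroup q q′ turn))
      where
      regroup : ∀ q q′ v → 0 + (q′ + v) + q ≡ q + v + 0 + q′
      regroup = solve-∀
    v+q≋0 : turn + q ≋ 0
    v+q≋0 = ≋-trans (≋-reflexive (+-comm turn q)) q+v≋0
    top : ∀ c → q + c ≡ k → c ≤ exit-back k × c ≤ enter-forth k
    top zero    eq = z≤n , z≤n
    top (suc c) eq = subst (λ i → suc c ≤ exit-back i × suc c ≤ enter-forth i) 1+q+c≡k
      (climb-both c (≤-reflexive 1+q+c≡k) (turn-suc v+q≋0)
        (first (exit-forth≤k q<k) (exit-back≤k q<k) (exit-turn q<k)
        , first (enter-back≤k q<k) (enter-forth≤k q<k) (enter-turn q<k)))
      where
      1+q+c≡k : suc q + c ≡ k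
      1+q+c≡k = trans (sym (+-suc q c)) eq
      q<k : suc q ≤ k
      q<k = ≤-trans (m≤m+n (suc q) c) (≤-reflexive 1+q+c≡k)
      first : ∀ {a b} → a ≤ k → b ≤ k → a + (turn + suc q) ≋ b → 1 ≤ b
      first {a} {b} a≤k b≤k e = ≤-trans (m≤n+m 1 a) (≤-reflexive (sym
        (lift v+q≋0 (subst (_≤ k) (sym (+-identityʳ a)) a≤k) b≤k e)))

record CombLabels (δ : ℕ) : Set where
  field
    forth back inward outward : ℕ → ℕ
    forth≤δ   : ∀ i → forth i ≤ δ
    back≤δ    : ∀ i → back i ≤ δ
    inward≤δ  : ∀ i → inward i ≤ δ

  open Congruence δ

  forth-wait back-wait exit-forth exit-back enter-forth enter-back turn : ℕ → ℕ
  forth-wait i  = wait (forth (pred i)) (forth i)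
  back-wait i   = wait (back i) (back (pred i))
  exit-forth i  = wait (forth (pred i)) (outward i)
  exit-back i   = wait (back i) (outward i)
  enter-forth i = wait (inward i) (forth i)
  enter-back i  = wait (inward i) (back (pred i))
  turn i        = wait (back i) (forth i)

  exit-balance : ∀ i → exit-forth i + turn i ≋ exit-back i + forth-wait i
  exit-balance i = ≋-by
    (wait-≋ (outward i) (forth≤δ (pred i)) ⊕ ≋-sym (wait-≋ (outward i) (back≤δ i))
      ⊕ ≋-sym (wait-≋ (forth i) (forth≤δ (pred i))) ⊕ wait-≋ (forth i) (back≤δ i))
    (regroup (forth (pred i)) (forth i) (back i) (outward i) (exit-forth i) (exit-back i)
      (forth-wait i) (turn i))
    where
    regroup : ∀ f′ f r o s s′ x v → o + suc (r + s′) + suc (f′ + x) + f + (s + v) ≡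
                                    suc (f′ + s) + o + f + suc (r + v) + (s′ + x)
    regroup = solve-∀

  enter-balance : ∀ i → enter-back i + turn i ≋ enter-forth i + back-wait i
  enter-balance i = ≋-by
    (wait-≋ (back (pred i)) (inward≤δ i) ⊕ ≋-sym (wait-≋ (forth i) (inward≤δ i))
      ⊕ ≋-sym (wait-≋ (back (pred i)) (back≤δ i)) ⊕ wait-≋ (forth i) (back≤δ i))
    (regroup (back (pred i)) (forth i) (back i) (inward i) (enter-forth i) (enter-back i)
      (back-wait i) (turn i))
    where
    regroup : ∀ r′ f r a t t′ y v → r′ + suc (a + t) + suc (r + y) + f + (t′ + v) ≡
                                    suc (a + t′) + f + r′ + suc (r + v) + (t + y)
    regroup = solve-∀

  turn-step : ∀ i → turn i + (2 + (forth-wait (suc i) + back-wait (suc i))) ≋ turn (suc i)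
  turn-step i = ≋-by
    (wait-≋ (forth i) (back≤δ i) ⊕ ≋-sym (wait-≋ (forth (suc i)) (back≤δ (suc i)))
      ⊕ wait-≋ (forth (suc i)) (forth≤δ i) ⊕ wait-≋ (back i) (back≤δ (suc i)))
    (regroup (back i) (forth i) (back (suc i)) (forth (suc i)) (forth-wait (suc i))
      (back-wait (suc i)) (turn i) (turn (suc i)))
    where
    regroup : ∀ r f r′ f′ x y v v′ → f + suc (r′ + v′) + f′ + r + (v + (2 + (x + y))) ≡
                                     suc (r + v) + f′ + suc (f + x) + suc (r′ + y) + v′
    regroup = solve-∀

  turn-advance : ∀ i n → turn i + (n * 2 + (Sum forth-wait (suc i) n + Sum back-wait (suc i) n)) ≋
    turn (i + n)
  turn-advance i zero    = ≋-reflexive (trans (+-identityʳ _) (cong turn (sym (+-identityʳ i))))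
  turn-advance i (suc n) = ≋-trans
    (≋-trans (≋-reflexive (regroup (turn i) (n * 2) (Sum forth-wait (suc i) n)
      (Sum back-wait (suc i) n) _ _))
      (turn-advance i n ⊕ ≋-refl))
    (≋-trans (turn-step (i + n)) (≋-reflexive (cong turn (sym (+-suc i n)))))
    where
    regroup : ∀ v n X Y x y → v + (2 + n + (X + x + (Y + y))) ≡ v + (n + (X + Y)) + (2 + (x + y))
    regroup = solve-∀

-- The blocks of the spine

module Layout (η k : ℕ) where

  δ : ℕ
  δ = η * 2

  open Congruence δ public

  run-length block-length order : ℕ
  run-length   = suc k * suc δ
  block-length = (2 + suc (k + k) * suc k) * suc δ
  order        = suc k * block-length

  -- Twice i minus one, modulo the period: the turn at position i in the
  -- intended labelling.
  phase : ℕ → ℕ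
  phase i = i * 2 + δ

  phase-+ : ∀ i n → phase (i + n) ≡ phase i + n * 2
  phase-+ i n = regroup i n δ
    where
    regroup : ∀ i n d → (i + n) * 2 + d ≡ i * 2 + d + n * 2
    regroup = solve-∀

  half : ∀ c → c * suc η * 2 ≋ c
  half c = ≋-trans (≋-reflexive (regroup c η)) (+-period c c)
    where
    regroup : ∀ c h → c * suc h * 2 ≡ c + c * suc (h * 2)
    regroup = solve-∀

  record InBlock (b i : ℕ) : Set where
    constructor in-block
    field
      lower : b * block-length ≤ i
      upper : i < suc b * block-length

  module _ (1≤k : 1 ≤ k) (k<δ : k < δ)
           (labels : CombLabels δ) (Hub : ℕ → Set)
           (hub : ∀ {b i m} → b ≤ k → m ≤ k → InBlock b i → phase i + k ≋ b + m → Hub i)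
    where
    open CombLabels labels

    module _ (budget : ∀ i n → Hub i → Hub (suc (i + n)) → suc (i + n) < order →
                enter-forth i + Sum forth-wait (suc i) n + exit-forth (suc (i + n)) ≤ k ×
                exit-back i + Sum back-wait (suc i) n + enter-back (suc (i + n)) ≤ k)
      where

      <order : ∀ {b i} → b ≤ k → InBlock b i → i < order
      <order b≤k i∈b = <-≤-trans (InBlock.upper i∈b) (*-monoˡ-≤ block-length (s≤s b≤k))

      forth-budget : ∀ {i j} → i < j → j < order → Hub i → Hub j → enter-forth i + exit-forth j ≤ k
      forth-budget {i} i<j j<N hᵢ hⱼ with n , refl ← m≤n⇒∃[o]m+o≡n i<j =
        ≤-trans (+-monoˡ-≤ _ (m≤m+n (enter-forth i) _)) (proj₁ (budget i n hᵢ hⱼ j<N))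

      back-budget : ∀ {i j} → i < j → j < order → Hub i → Hub j → exit-back i + enter-back j ≤ k
      back-budget {i} i<j j<N hᵢ hⱼ with n , refl ← m≤n⇒∃[o]m+o≡n i<j =
        ≤-trans (+-monoˡ-≤ _ (m≤m+n (exit-back i) _)) (proj₂ (budget i n hᵢ hⱼ j<N))

      record Anchors (b : ℕ) : Set where
        field
          first last  : ℕ
          deficit height : ℕ
          first∈      : InBlock b first
          last∈       : InBlock b last
          first-hub   : Hub first
          last-hub    : Hub last
          deficit+height : deficit + height ≡ k
          first-turn  : deficit + turn first ≋ 0
          last-turn   : turn last ≋ height
          first-phase : phase first + k ≋ b
          last-phase  : phase last ≋ b
          first-forth : forth-wait first ≡ 0
          first-back  : back-wait first ≡ 0
          deficit≤exit  : deficit ≤ exit-forth first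
          deficit≤enter : deficit ≤ enter-back first
          height≤exit   : height ≤ exit-back last
          height≤enter  : height ≤ enter-forth last

      module Block {b : ℕ} (b≤k : b ≤ k) where

        base guard-gap search left right : ℕ
        base        = b * block-length
        search    = suc (k + k) * run-length
        guard-gap = search + δ
        left      = base + suc η
        right     = suc (left + guard-gap)

        block-≋ : ∀ i → base * 2 + i ≋ i
        block-≋ i = ≋-trans (≋-reflexive (regroup b (2 + suc (k + k) * suc k) (suc δ) i))
                            (+-period i (b * (2 + suc (k + k) * suc k) * 2))
          where
          regroup : ∀ b c d i → b * (c * d) * 2 + i ≡ i + b * c * 2 * d
          regroup = solve-∀

        left-phase : phase left ≋ 0
        left-phase = ≋-trans (≋-reflexive (regroup base η))
          (≋-trans (block-≋ (2 * suc δ)) (+-period 0 2))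
          where
          regroup : ∀ B h → (B + suc h) * 2 + h * 2 ≡ B * 2 + 2 * suc (h * 2)
          regroup = solve-∀

        right-phase : phase right ≋ 0
        right-phase = ≋-trans (≋-reflexive (trans (cong phase (sym (+-suc left guard-gap)))
          (phase-+ left (suc guard-gap))))
          (≋-trans (≋-reflexive (cong (phase left +_) (regroup k δ)))
            (≋-trans (+-period (phase left) (suc (suc (k + k) * suc k) * 2)) left-phase))
          where
          regroup : ∀ k d → suc (suc (k + k) * (suc k * suc d) + d) * 2 ≡
            suc (suc (k + k) * suc k) * 2 * suc d
          regroup = solve-∀

        suc-right : suc right ≡ suc (suc η) + (suc guard-gap + base)
        suc-right = regroup base η guard-gap
          where
          regroup : ∀ B h g → suc (suc (B + suc h + g)) ≡ suc (suc h) + (suc g + B)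
          regroup = solve-∀

        1+η<Δ : suc (suc η) ≤ suc δ
        1+η<Δ = positive η k<δ
          where
          positive : ∀ h → k < h * 2 → suc (suc h) ≤ suc (h * 2)
          positive (suc h) _ = s≤s (s≤s (s≤s (m≤m*n h 2)))

        right< : right < suc b * block-length
        right< = ≤-trans (≤-reflexive suc-right)
          (≤-trans (+-monoˡ-≤ _ 1+η<Δ) (≤-reflexive (regroup k δ base)))
          where
          regroup : ∀ k d B → suc d + (suc (suc (k + k) * (suc k * suc d) + d) + B) ≡
            (2 + suc (k + k) * suc k) * suc d + B
          regroup = solve-∀

        left<right : left < right
        left<right = s≤s (m≤m+n left guard-gap)

        left∈ : InBlock b left
        left∈ = in-block (m≤m+n base (suc η)) (<-trans left<right right<)

        right∈ : InBlock b right
        right∈ = in-block (≤-trans (InBlock.lower left∈) (<⇒≤ left<right)) right<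

        between : ∀ {i} → left < i → i < right → InBlock b i
        between l<i i<r = in-block (≤-trans (InBlock.lower left∈) (<⇒≤ l<i)) (<-trans i<r right<)

        phase≋0⇒Hub : ∀ {i} → InBlock b i → phase i ≋ 0 → Hub i
        phase≋0⇒Hub i∈ i≋0 = hub b≤k (m∸n≤m k b) i∈
          (≋-trans (i≋0 ⊕ ≋-refl {k}) (≋-reflexive (sym (m+[n∸m]≡n b≤k))))

        left-hub : Hub left
        left-hub = phase≋0⇒Hub left∈ left-phase

        right-hub : Hub right
        right-hub = phase≋0⇒Hub right∈ right-phase

        waits : ℕ → ℕ
        waits i = forth-wait i + back-wait i

        few-waits : Sum waits (suc left) search ≤ k + k
        few-waits = begin
          Sum waits (suc left) search    ≤⟨ Sum-monoʳ waits (suc left) (m≤m+n search δ) ⟩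
          Sum waits (suc left) guard-gap ≡⟨ Sum-distrib forth-wait back-wait (suc left) guard-gap ⟩
          Sum forth-wait (suc left) guard-gap + Sum back-wait (suc left) guard-gap
            ≤⟨ +-mono-≤ (middle≤ (enter-forth left) (proj₁ total))
              (middle≤ (exit-back left) (proj₂ total)) ⟩
          k + k ∎
          where
          open ≤-Reasoning
          total = budget left guard-gap left-hub right-hub (<order b≤k right∈)
          middle≤ : ∀ a {m c} → a + m + c ≤ k → m ≤ k
          middle≤ a {m} a+m+c≤k = m+n≤o⇒n≤o a (m+n≤o⇒m≤o (a + m) a+m+c≤k)

        module Run (origin : ℕ) (left<origin : left < origin)
                   (origin+run≤ : origin + run-length ≤ suc left + search)
                   (quiet : ∀ l → l < run-length → waits (origin + l) ≡ 0)
          where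

          offset : ℕ
          offset = ((b + δ * (phase origin + k)) * suc η) % suc δ

          offset≤δ : offset ≤ δ
          offset≤δ = s≤s⁻¹ (m%n<n ((b + δ * (phase origin + k)) * suc η) (suc δ))

          bottom : ℕ
          bottom = origin + offset

          rung : ℕ → ℕ
          rung m = bottom + m * suc η

          rung₀ : rung 0 ≡ bottom
          rung₀ = +-identityʳ bottom

          bottom-phase : phase bottom + k ≋ b
          bottom-phase = ≋-trans (≋-reflexive (trans (cong (_+ k) (phase-+ origin offset))
            (regroup₁ (phase origin) offset k)))
            (≋-trans (≋-refl {phase origin + k} ⊕ offset-≋)
              (≋-trans (≋-reflexive (regroup₂ (phase origin + k) b δ))
                (+-period b (phase origin + k))))
            where
            offset-≋ : 2 * offset ≋ b + δ * (phase origin + k)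
            offset-≋ = ≋-trans (≋-*ˡ 2 (%-≋ ((b + δ * (phase origin + k)) * suc η)))
              (≋-trans (≋-reflexive (*-comm 2 ((b + δ * (phase origin + k)) * suc η)))
                (half (b + δ * (phase origin + k))))
            regroup₁ : ∀ s e k → s + e * 2 + k ≡ s + k + 2 * e
            regroup₁ = solve-∀
            regroup₂ : ∀ s b d → s + (b + d * s) ≡ b + s * suc d
            regroup₂ = solve-∀

          rung-phase : ∀ m → phase (rung m) + k ≋ b + m
          rung-phase m = ≋-trans (≋-reflexive (trans (cong (_+ k) (phase-+ bottom (m * suc η)))
            (regroup (phase bottom) k (m * suc η * 2))))
            (bottom-phase ⊕ half m)
            where
            regroup : ∀ s k e → s + e + k ≡ s + k + e
            regroup = solve-∀

          run-offset : ∀ {m} → m ≤ k → offset + m * suc η < run-length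
          run-offset m≤k = s≤s (+-mono-≤ offset≤δ (*-mono-≤ m≤k (≤-trans (n≤1+n _) 1+η<Δ)))

          rung-quiet : ∀ {m} → m ≤ k → waits (rung m) ≡ 0
          rung-quiet {m} m≤k = trans (cong waits (+-assoc origin offset _)) (quiet _ (run-offset m≤k))

          rung-forth : ∀ {m} → m ≤ k → forth-wait (rung m) ≡ 0
          rung-forth m≤k = m+n≡0⇒m≡0 _ (rung-quiet m≤k)

          rung-back : ∀ {m} → m ≤ k → back-wait (rung m) ≡ 0
          rung-back {m} m≤k = m+n≡0⇒n≡0 (forth-wait (rung m)) (rung-quiet m≤k)

          left<rung : ∀ m → left < rung m
          left<rung m = ≤-trans left<origin (≤-trans (m≤m+n origin offset) (m≤m+n bottom (m * suc η)))

          rung<right : ∀ {m} → m ≤ k → rung m < right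
          rung<right {m} m≤k = begin-strict
            rung m                      ≡⟨ +-assoc origin offset _ ⟩
            origin + (offset + m * suc η) <⟨ +-monoʳ-< origin (run-offset m≤k) ⟩
            origin + run-length          ≤⟨ origin+run≤ ⟩
            suc left + search           ≤⟨ +-monoʳ-≤ (suc left) (m≤m+n search δ) ⟩
            right                       ∎
            where open ≤-Reasoning

          rung∈ : ∀ {m} → m ≤ k → InBlock b (rung m)
          rung∈ {m} m≤k = between (left<rung m) (rung<right m≤k)

          rung-hub : ∀ {m} → m ≤ k → Hub (rung m)
          rung-hub {m} m≤k = hub b≤k m≤k (rung∈ m≤k) (rung-phase m)

          rung-turn : ∀ {m} → m ≤ k → turn bottom + m ≋ turn (rung m)
          rung-turn {m} m≤k = ≋-trans (≋-refl {turn bottom} ⊕ ≋-sym (half m))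
            (≋-trans (≋-reflexive (cong (turn bottom +_)
              (sym (trans (cong (m * suc η * 2 +_) (cong₂ _+_
                (silent forth-wait (λ i → m+n≡0⇒m≡0 (forth-wait i)))
                  (silent back-wait (λ i → m+n≡0⇒n≡0 (forth-wait i)))))
                (+-identityʳ (m * suc η * 2))))))
              (turn-advance bottom (m * suc η)))
            where
            silent : ∀ f → (∀ i → waits i ≡ 0 → f i ≡ 0) → Sum f (suc bottom) (m * suc η) ≡ 0
            silent f f≤ = Sum-zero (suc bottom) (m * suc η) λ l l<n → f≤ _
              (trans (cong waits (regroup origin offset l))
                (quiet _ (≤-<-trans (+-monoʳ-≤ offset l<n) (run-offset m≤k))))
              where
              regroup : ∀ s e l → suc (s + e + l) ≡ s + (e + suc l)
              regroup = solve-∀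

          ladder : Ladder δ k
          ladder = record
            { k<δ  = k<δ
            ; turn = turn bottom
            ; exit-forth  = λ m → exit-forth (rung m)
            ; exit-back   = λ m → exit-back (rung m)
            ; enter-forth = λ m → enter-forth (rung m)
            ; enter-back  = λ m → enter-back (rung m)
            ; exit-forth≤k  = λ {m} m≤k → m+n≤o⇒n≤o (enter-forth left)
                (forth-budget (left<rung m) (<order b≤k (rung∈ m≤k)) left-hub (rung-hub m≤k))
            ; exit-back≤k   = λ {m} m≤k → m+n≤o⇒m≤o (exit-back (rung m))
                (back-budget (rung<right m≤k) (<order b≤k right∈) (rung-hub m≤k) right-hub)
            ; enter-forth≤k = λ {m} m≤k → m+n≤o⇒m≤o (enter-forth (rung m))
                (forth-budget (rung<right m≤k) (<order b≤k right∈) (rung-hub m≤k) right-hub)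
            ; enter-back≤k  = λ {m} m≤k → m+n≤o⇒n≤o (exit-back left)
                (back-budget (left<rung m) (<order b≤k (rung∈ m≤k)) left-hub (rung-hub m≤k))
            ; exit-turn  = λ {m} m≤k → ≋-trans (≋-refl {exit-forth (rung m)} ⊕ rung-turn m≤k)
                (≋-trans (exit-balance (rung m))
                  (≋-reflexive (trans (cong (exit-back (rung m) +_) (rung-forth m≤k))
                    (+-identityʳ _))))
            ; enter-turn = λ {m} m≤k → ≋-trans (≋-refl {enter-back (rung m)} ⊕ rung-turn m≤k)
                (≋-trans (enter-balance (rung m))
                  (≋-reflexive (trans (cong (enter-forth (rung m) +_) (rung-back m≤k))
                    (+-identityʳ _))))
            ; forth-budget = λ {m} m<k → forth-budget (rung< m) (<order b≤k (rung∈ m<k))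
              (rung-hub (<⇒≤ m<k)) (rung-hub m<k)
            ; back-budget  = λ {m} m<k → back-budget (rung< m) (<order b≤k (rung∈ m<k))
              (rung-hub (<⇒≤ m<k)) (rung-hub m<k)
            }
            where
            rung< : ∀ m → rung m < rung (suc m)
            rung< m = +-monoʳ-< bottom (m<n+m (m * suc η) (s≤s z≤n))

          height = Ladder.ladder-height ladder
          deficit+height = proj₁ (proj₂ (proj₂ height))
          deficit+turn = proj₁ (proj₂ (proj₂ (proj₂ height)))
          bounds = proj₂ (proj₂ (proj₂ (proj₂ height)))

          regroup-phase : ∀ b k p → b + k + p ≡ p + k + b
          regroup-phase = solve-∀
          close : ∀ {q c n v t} → q + c ≡ n → q + v ≋ 0 → v + n ≋ t → t ≋ c
          close {q} {c} {v = v} {t} refl q+v≋0 v+n≋t = ≋-by (≋-sym v+n≋t ⊕ q+v≋0) (regroup q c v t)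
            where
            regroup : ∀ q c v t → v + (q + c) + 0 + t ≡ t + (q + v) + c
            regroup = solve-∀

          run-anchors : Anchors b
          run-anchors = record
            { first = rung 0
            ; last  = rung k
            ; deficit = proj₁ height
            ; height  = proj₁ (proj₂ height)
            ; first∈ = rung∈ z≤n
            ; last∈  = rung∈ ≤-refl
            ; first-hub = rung-hub z≤n
            ; last-hub  = rung-hub ≤-refl
            ; deficit+height = deficit+height
            ; first-turn = subst (λ i → proj₁ height + turn i ≋ 0) (sym rung₀) deficit+turn
            ; last-turn  = close deficit+height deficit+turn (rung-turn ≤-refl)
            ; first-phase = ≋-trans (rung-phase 0) (≋-reflexive (+-identityʳ b))
            ; last-phase  = ≋-by (rung-phase k) (regroup-phase b k (phase (rung k)))
            ; first-forth = rung-forth z≤n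
            ; first-back  = rung-back z≤n
            ; deficit≤exit  = proj₁ bounds
            ; deficit≤enter = proj₁ (proj₂ bounds)
            ; height≤exit   = proj₁ (proj₂ (proj₂ bounds))
            ; height≤enter  = proj₂ (proj₂ (proj₂ bounds))
            }

        anchors : Anchors b
        anchors = Run.run-anchors (proj₁ run) (proj₁ (proj₂ run)) (proj₁ (proj₂ (proj₂ run)))
          (proj₂ (proj₂ (proj₂ run)))
          where run = zero-run waits run-length (k + k) (suc left) few-waits

      record Gap {b} (p : Anchors b) (q : Anchors (suc b)) : Set where
        private
          module p = Anchors p
          module q = Anchors q
        field
          gap : ℕ
          meets : suc (p.last + gap) ≡ q.first
          rise  : suc (Sum forth-wait (suc p.last) gap + Sum back-wait (suc p.last) gap) +
            p.height ≡ q.height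

      gap-between : ∀ {b} → suc b ≤ k → (p : Anchors b) (q : Anchors (suc b)) → Gap p q
      gap-between {b} b<k p q = record { gap = n ; meets = meets ; rise = rise }
        where
        module p = Anchors p
        module q = Anchors q
        p<q : p.last < q.first
        p<q = <-≤-trans (InBlock.upper p.last∈) (InBlock.lower q.first∈)

        n X Y : ℕ
        n = proj₁ (m≤n⇒∃[o]m+o≡n p<q)
        X = Sum forth-wait (suc p.last) n
        Y = Sum back-wait (suc p.last) n

        meets : suc (p.last + n) ≡ q.first
        meets = proj₂ (m≤n⇒∃[o]m+o≡n p<q)

        meets′ : p.last + suc n ≡ q.first
        meets′ = trans (+-suc p.last n) meets

        phases : suc n * 2 + (q.deficit + q.height) ≋ 1
        phases = ≋-by (q.first-phase ⊕ ≋-sym p.last-phase) (begin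
          suc b + phase p.last + (suc n * 2 + (q.deficit + q.height))
            ≡⟨ cong (λ c → suc b + phase p.last + (suc n * 2 + c)) q.deficit+height ⟩
          suc b + phase p.last + (suc n * 2 + k)   ≡⟨ regroup b (phase p.last) (suc n * 2) k ⟩
          phase p.last + suc n * 2 + k + b + 1
            ≡⟨ cong (λ c → c + k + b + 1)
              (sym (trans (cong phase (sym meets′)) (phase-+ p.last (suc n)))) ⟩
          phase q.first + k + b + 1                ∎)
          where
          open ≡-Reasoning
          regroup : ∀ b c d k → suc b + c + (d + k) ≡ c + d + k + b + 1
          regroup = solve-∀

        extend : ∀ f → f q.first ≡ 0 → Sum f (suc p.last) (suc n) ≡ Sum f (suc p.last) n
        extend f f≡0 = trans (cong (Sum f (suc p.last) n +_) (trans (cong f meets) f≡0))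
          (+-identityʳ _)

        turns : turn p.last + (suc n * 2 + (X + Y)) ≋ turn q.first
        turns = subst₂ (λ c d → turn p.last + (suc n * 2 + c) ≋ turn d)
          (cong₂ _+_ (extend forth-wait q.first-forth) (extend back-wait q.first-back)) meets′
          (turn-advance p.last (suc n))

        rise-≋ : suc (X + Y) + p.height ≋ q.height
        rise-≋ = ≋-by (≋-sym p.last-turn ⊕ turns ⊕ q.first-turn ⊕ ≋-sym phases)
          (regroup p.height (turn p.last) (turn q.first) (suc n * 2) X Y q.deficit q.height)
          where
          regroup : ∀ h u w g x y d h′ → u + w + 0 + (g + (d + h′)) + (suc (x + y) + h) ≡
                                         h + (u + (g + (x + y))) + (d + w) + 1 + h′
          regroup = solve-∀

        fits : ∀ {a c m} → p.height ≤ a → q.deficit ≤ c → a + m + c ≤ k → p.height + m ≤ q.height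
        fits {a} {c} {m} h≤a d≤c a+m+c≤k = +-cancelʳ-≤ q.deficit _ _ (≤-trans
          (≤-trans (+-mono-≤ (+-monoˡ-≤ m h≤a) d≤c) a+m+c≤k)
          (≤-reflexive (trans (sym q.deficit+height) (+-comm q.deficit q.height))))

        total = budget p.last n p.last-hub (subst Hub (sym meets) q.first-hub)
          (subst (_< order) (sym meets) (<order b<k q.first∈))

        forth-fits : p.height + X ≤ q.height
        forth-fits = fits p.height≤enter q.deficit≤exit
          (subst (λ i → enter-forth p.last + X + exit-forth i ≤ k) meets (proj₁ total))

        back-fits : p.height + Y ≤ q.height
        back-fits = fits p.height≤exit q.deficit≤enter
          (subst (λ i → exit-back p.last + Y + enter-back i ≤ k) meets (proj₂ total))

        height≤k : q.height ≤ k
        height≤k = subst (q.height ≤_) q.deficit+height (m≤n+m q.height q.deficit)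

        rise : suc (X + Y) + p.height ≡ q.height
        rise = exact (m≤n⇒∃[o]m+o≡n forth-fits)
          where
          exact : ∃[ f ] p.height + X + f ≡ q.height → suc (X + Y) + p.height ≡ q.height
          exact (f , eq) = trans (regroup₁ X Y p.height) (trans (cong (p.height + X +_) 1+Y≡f) eq)
            where
            regroup₁ : ∀ x y h → suc (x + y) + h ≡ h + x + suc y
            regroup₁ = solve-∀
            1+Y≡f : suc Y ≡ f
            1+Y≡f = ≋⇒≡
              (≤-<-trans (m+n≤o⇒n≤o p.height back-fits) (≤-<-trans height≤k k<δ))
              (≤-trans (m+n≤o⇒n≤o (p.height + X) (≤-reflexive eq)) (≤-trans height≤k (<⇒≤ k<δ)))
              (+-cancelˡ-≋ (p.height + X) (≋-trans (≋-reflexive (sym (regroup₁ X Y p.height)))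
                (≋-trans rise-≋ (≋-reflexive (sym eq)))))

      anchors-at : ∀ b → b ≤ k → Anchors b
      anchors-at b b≤k = Block.anchors b≤k

      heights-grow : ∀ n {b} (b+n≤k : b + n ≤ k) (p : Anchors b) →
                     Anchors.height p + n ≤ k
      heights-grow zero    {b} b≤k p = subst₂ _≤_ (sym (+-identityʳ _)) (Anchors.deficit+height p)
        (m≤n+m _ _)
      heights-grow (suc n) {b} b+n≤k p = begin
        Anchors.height p + suc n         ≡⟨ +-suc (Anchors.height p) n ⟩
        suc (Anchors.height p) + n       ≤⟨ +-monoˡ-≤ n
          (≤-trans (s≤s (m≤n+m (Anchors.height p) _)) (≤-reflexive (Gap.rise step))) ⟩
        Anchors.height next + n          ≤⟨ heights-grow n 1+b+n≤k next ⟩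
        k                                ∎
        where
        open ≤-Reasoning
        1+b+n≤k : suc b + n ≤ k
        1+b+n≤k = subst (_≤ k) (+-suc b n) b+n≤k
        b<k : suc b ≤ k
        b<k = m+n≤o⇒m≤o (suc b) 1+b+n≤k
        next = anchors-at (suc b) b<k
        step = gap-between b<k p next

      -- The heights rise by at least one from block to block and stay between
      -- 0 and k, so the first gap contains no superfluous waiting at all.
      forth≡back : forth block-length ≡ back block-length
      forth≡back = ≋⇒≡ (forth≤δ block-length) (back≤δ block-length) (≋-sym (≋-trans
        (≋-trans (≋-sym (+-period (back block-length) 1))
          (≋-reflexive (trans (regroup (back block-length) δ)
          (cong (λ c → suc (back block-length + c)) (sym turn≡δ)))))
        (wait-≋ (forth block-length) (back≤δ block-length))))
        where
        regroup : ∀ r d → r + 1 * suc d ≡ suc (r + d)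
        regroup = solve-∀

        p₀ = anchors-at 0 z≤n
        p₁ = anchors-at 1 1≤k
        module p₀ = Anchors p₀
        module p₁ = Anchors p₁
        module g = Gap (gap-between 1≤k p₀ p₁)

        p₁-low : p₁.height ≤ 1
        p₁-low = +-cancelʳ-≤ (pred k) _ _ (≤-trans
          (heights-grow (pred k) (≤-reflexive 1+pred) p₁) (≤-reflexive (sym 1+pred)))
          where
          1+pred : 1 + pred k ≡ k
          1+pred = suc-pred k {{>-nonZero 1≤k}}

        X Y : ℕ
        X = Sum forth-wait (suc p₀.last) g.gap
        Y = Sum back-wait (suc p₀.last) g.gap

        tight : X + Y + p₀.height ≡ 0
        tight = n≤0⇒n≡0 (s≤s⁻¹ (≤-trans (≤-reflexive g.rise) p₁-low))

        X≡0 : X ≡ 0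
        X≡0 = m+n≡0⇒m≡0 X (m+n≡0⇒m≡0 (X + Y) tight)
        Y≡0 : Y ≡ 0
        Y≡0 = m+n≡0⇒n≡0 X (m+n≡0⇒m≡0 (X + Y) tight)
        height≡0 : p₀.height ≡ 0
        height≡0 = m+n≡0⇒n≡0 (X + Y) tight

        last≤ : p₀.last ≤ block-length
        last≤ = ≤-trans (<⇒≤ (InBlock.upper p₀.last∈)) (≤-reflexive (+-identityʳ block-length))

        n : ℕ
        n = proj₁ (m≤n⇒∃[o]m+o≡n last≤)
        last+n : p₀.last + n ≡ block-length
        last+n = proj₂ (m≤n⇒∃[o]m+o≡n last≤)

        n≤gap : n ≤ suc g.gap
        n≤gap = +-cancelˡ-≤ p₀.last _ _ (≤-trans (≤-reflexive last+n)
          (≤-trans (≤-trans (≤-reflexive (sym (+-identityʳ block-length))) (InBlock.lower p₁.first∈))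
            (≤-reflexive (sym (trans (+-suc p₀.last g.gap) g.meets)))))

        silent : ∀ f → f p₁.first ≡ 0 → Sum f (suc p₀.last) g.gap ≡ 0 → Sum f (suc p₀.last) n ≡ 0
        silent f f≡0 Σ≡0 = n≤0⇒n≡0 (≤-trans (Sum-monoʳ f (suc p₀.last) n≤gap)
          (≤-reflexive (cong₂ _+_ Σ≡0 (trans (cong f g.meets) f≡0))))

        turn-block : turn p₀.last + n * 2 ≋ turn block-length
        turn-block = subst₂ (λ c d → turn p₀.last + c ≋ turn d)
          (trans (cong (n * 2 +_) (cong₂ _+_ (silent forth-wait p₁.first-forth X≡0)
            (silent back-wait p₁.first-back Y≡0)))
            (+-identityʳ (n * 2))) last+n (turn-advance p₀.last n)

        block-phase : phase block-length ≋ δ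
        block-phase = ≋-trans (≋-reflexive (regroup′ (2 + suc (k + k) * suc k) δ))
          (+-period δ ((2 + suc (k + k) * suc k) * 2))
          where
          regroup′ : ∀ c d → c * suc d * 2 + d ≡ d + c * 2 * suc d
          regroup′ = solve-∀

        turn≡δ : turn block-length ≡ δ
        turn≡δ = ≋⇒≡ (wait≤δ (back block-length) (forth block-length)) ≤-refl
          (≋-trans (≋-sym turn-block)
          (≋-trans (p₀.last-turn ⊕ ≋-refl {n * 2}) (≋-trans (≋-reflexive (cong (_+ n * 2) height≡0))
            (≋-trans (≋-sym p₀.last-phase ⊕ ≋-refl {n * 2})
              (≋-trans (≋-reflexive (trans (sym (phase-+ p₀.last n)) (cong phase last+n)))
                block-phase)))))

-- Trees with a sense of direction

record Compass (G : Digraph) : Set where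
  open Digraph G
  field
    toward          : V → V → V
    dist            : V → V → ℕ
    toward-neighbour : ∀ {u w} → Arc u w → toward u w ≡ w
    toward-stable   : ∀ {u z z′} → Arc z z′ → z ≢ u → z′ ≢ u → toward u z ≡ toward u z′
    toward-arc      : ∀ {u z} → u ≢ z → Arc u (toward u z)
    dist-refl       : ∀ z → dist z z ≡ 0
    dist-step       : ∀ {u z} → u ≢ z → dist u z ≡ suc (dist (toward u z) z)

  route : V → V → ℕ → V
  route s z zero    = s
  route s z (suc i) = toward (route s z i) z

  dist≡0⇒≡ : ∀ {u z} → dist u z ≡ 0 → u ≡ z
  dist≡0⇒≡ {u} {z} d≡0 with u Fin.≟ z
  ... | yes u≡z = u≡z
  ... | no  u≢z = contradiction (trans (sym (dist-step u≢z)) d≡0) λ ()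

  dist-route : ∀ {s z} i → i ≤ dist s z → dist (route s z i) z + i ≡ dist s z
  route-≢    : ∀ {s z} i → i < dist s z → route s z i ≢ z

  dist-route zero    _   = +-identityʳ _
  dist-route {s} {z} (suc i) i<d = begin
    dist (route s z (suc i)) z + suc i   ≡⟨ +-suc _ i ⟩
    suc (dist (route s z (suc i)) z) + i ≡⟨ cong (_+ i) (dist-step (route-≢ i i<d)) ⟨
    dist (route s z i) z + i             ≡⟨ dist-route i (<⇒≤ i<d) ⟩
    dist s z                             ∎
    where open ≡-Reasoning

  route-≢ {s} {z} i i<d eq = <⇒≢ i<d (begin
    i                          ≡⟨ cong (_+ i) (dist-refl z) ⟨
    dist z z + i               ≡⟨ cong (λ u → dist u z + i) eq ⟨
    dist (route s z i) z + i   ≡⟨ dist-route i (<⇒≤ i<d) ⟩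
    dist s z                   ∎)
    where open ≡-Reasoning

  route-path : ∀ {s z ℓ} → dist s z ≡ ℓ → Path s z ℓ
  route-path {s} {z} {ℓ} d≡ℓ = record
    { vertex   = λ i → route s z (toℕ i)
    ; start    = refl
    ; end      = dist≡0⇒≡ (+-cancelʳ-≡ (toℕ (fromℕ ℓ)) _ 0 (trans (remaining (fromℕ ℓ))
                   (trans d≡ℓ (sym (Fin.toℕ-fromℕ ℓ)))))
    ; distinct = λ {i} {j} eq → Fin.toℕ-injective (+-cancelˡ-≡ (dist (route s z (toℕ i)) z) _ _
                   (trans (remaining i) (trans (sym (remaining j))
                     (cong (λ u → dist u z + toℕ j) (sym eq)))))
    ; isArc    = λ i → subst (λ n → Arc (route s z n) (route s z (suc (toℕ i))))
      (sym (Fin.toℕ-inject₁ i))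
                   (toward-arc (route-≢ (toℕ i) (≤-trans (Fin.toℕ<n i) (≤-reflexive (sym d≡ℓ)))))
    }
    where
    remaining : (i : Fin (suc ℓ)) → dist (route s z (toℕ i)) z + toℕ i ≡ dist s z
    remaining i = dist-route (toℕ i) (≤-trans (s≤s⁻¹ (Fin.toℕ<n i)) (≤-reflexive (sym d≡ℓ)))

  -- A path cannot return to a vertex it has left, so all its later vertices
  -- lie in the direction of the next one.
  module _ {s z ℓ} (p : Path s z ℓ) where
    open Path p

    private
      at : ℕ → V
      at n with n <? suc ℓ
      ... | yes n≤ℓ = vertex (fromℕ< n≤ℓ)
      ... | no  _   = s

      at-toℕ : ∀ i → at (toℕ i) ≡ vertex i
      at-toℕ i with toℕ i <? suc ℓ
      ... | yes i≤ℓ = cong vertex (Fin.fromℕ<-toℕ i i≤ℓ)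
      ... | no  i≰ℓ = contradiction (Fin.toℕ<n i) i≰ℓ

      at-fromℕ< : ∀ {n} (n≤ℓ : n < suc ℓ) → at n ≡ vertex (fromℕ< n≤ℓ)
      at-fromℕ< n≤ℓ = trans (cong at (sym (Fin.toℕ-fromℕ< n≤ℓ))) (at-toℕ (fromℕ< n≤ℓ))

      at-end : at ℓ ≡ z
      at-end = trans (cong at (sym (Fin.toℕ-fromℕ ℓ))) (trans (at-toℕ (fromℕ ℓ)) end)

      at-injective : ∀ {m n} → m ≤ ℓ → n ≤ ℓ → at m ≡ at n → m ≡ n
      at-injective m≤ℓ n≤ℓ eq = begin
        _                       ≡⟨ Fin.toℕ-fromℕ< (s≤s m≤ℓ) ⟨
        toℕ (fromℕ< (s≤s m≤ℓ))  ≡⟨ cong toℕ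
          (distinct (trans (sym (at-fromℕ< (s≤s m≤ℓ))) (trans eq (at-fromℕ< (s≤s n≤ℓ))))) ⟩
        toℕ (fromℕ< (s≤s n≤ℓ))  ≡⟨ Fin.toℕ-fromℕ< (s≤s n≤ℓ) ⟩
        _                       ∎
        where open ≡-Reasoning

      at-arc : ∀ {n} → n < ℓ → Arc (at n) (at (suc n))
      at-arc n<ℓ = subst₂ Arc
        (trans (sym (at-toℕ (inject₁ i))) (cong at (trans (Fin.toℕ-inject₁ i) (Fin.toℕ-fromℕ< n<ℓ))))
        (trans (sym (at-toℕ (suc i))) (cong (λ m → at (suc m)) (Fin.toℕ-fromℕ< n<ℓ)))
        (isArc i)
        where i = fromℕ< n<ℓ

      at-toward : ∀ i j → suc (i + j) ≤ ℓ → toward (at i) (at (suc (i + j))) ≡ at (suc i)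
      at-toward i zero    i<ℓ rewrite +-identityʳ i = toward-neighbour (at-arc i<ℓ)
      at-toward i (suc j) i+j<ℓ rewrite +-suc i j = trans
        (sym (toward-stable (at-arc i+j<ℓ) (later (m≤m+n i j) (<⇒≤ i+j<ℓ))
          (later (m≤n⇒m≤1+n (m≤m+n i j)) i+j<ℓ)))
        (at-toward i j (<⇒≤ i+j<ℓ))
        where
        later : ∀ {m} → i ≤ m → suc m ≤ ℓ → at (suc m) ≢ at i
        later i≤m m<ℓ eq = <⇒≢ (s≤s i≤m) (sym (at-injective m<ℓ (≤-trans (m≤n⇒m≤1+n i≤m) m<ℓ) eq))

      at-route : ∀ i → i ≤ ℓ → at i ≡ route s z i
      at-route zero    _   = trans (at-toℕ zero) start
      at-route (suc i) i<ℓ with j , eq ← m≤n⇒∃[o]m+o≡n i<ℓ = begin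
        at (suc i)                       ≡⟨ at-toward i j (≤-reflexive eq) ⟨
        toward (at i) (at (suc (i + j)))
          ≡⟨ cong₂ toward (at-route i (<⇒≤ i<ℓ)) (trans (cong at eq) at-end) ⟩
        toward (route s z i) z           ∎
        where open ≡-Reasoning

      dist-at : ∀ i → i ≤ ℓ → dist (at i) z + i ≡ dist s z
      dist-at zero    _   = trans (+-identityʳ _) (cong (λ u → dist u z) (trans (at-toℕ zero) start))
      dist-at (suc i) i<ℓ = begin
        dist (at (suc i)) z + suc i          ≡⟨ +-suc _ i ⟩
        suc (dist (at (suc i)) z) + i        ≡⟨ cong (λ u → suc (dist u z) + i) next ⟩
        suc (dist (toward (at i) z) z) + i   ≡⟨ cong (_+ i) (dist-step at≢z) ⟨
        dist (at i) z + i                    ≡⟨ dist-at i (<⇒≤ i<ℓ) ⟩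
        dist s z                             ∎
        where
        open ≡-Reasoning
        at≢z : at i ≢ z
        at≢z eq = <⇒≢ i<ℓ (at-injective (<⇒≤ i<ℓ) ≤-refl (trans eq (sym at-end)))
        next : at (suc i) ≡ toward (at i) z
        next = trans (at-route (suc i) i<ℓ) (cong (λ u → toward u z) (sym (at-route i (<⇒≤ i<ℓ))))

    path-vertex : ∀ i → vertex i ≡ route s z (toℕ i)
    path-vertex i = trans (sym (at-toℕ i)) (at-route (toℕ i) (s≤s⁻¹ (Fin.toℕ<n i)))

    path-length : ℓ ≡ dist s z
    path-length = trans (cong (_+ ℓ) (sym (trans (cong (λ u → dist u z) at-end) (dist-refl z))))
      (dist-at ℓ ≤-refl)

  isDistance : ∀ u v → IsDistance u v (dist u v)
  isDistance u v = route-path refl , λ p → ≤-reflexive (sym (path-length p))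

  isBidirectedTree : Symmetric Arc → Irreflexive _≡_ Arc → V → IsBidirectedTree
  isBidirectedTree arc-sym arc-irrefl v = record
    { symmetric   = arc-sym
    ; irreflexive = arc-irrefl
    ; nonempty    = v
    ; connected   = λ u v → dist u v , route-path refl
    ; acyclic     = λ 2≤ℓ p v→u → short v→u (subst (2 ≤_) (path-length p) 2≤ℓ)
    }
    where
    short : ∀ {u v} → Arc v u → ¬ (2 ≤ dist u v)
    short {u} {v} v→u 2≤d = <⇒≱ 2≤d (≤-reflexive (begin
      dist u v                     ≡⟨ dist-step (λ u≡v → arc-irrefl (sym u≡v) v→u) ⟩
      suc (dist (toward u v) v)    ≡⟨ cong (λ w → suc (dist w v)) (toward-neighbour (arc-sym v→u)) ⟩
      suc (dist v v)               ≡⟨ cong suc (dist-refl v) ⟩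
      1                            ∎))
      where open ≡-Reasoning

  module Timing {δ : ℕ} (lab : Labeling (suc δ)) where
    open Congruence δ

    label : V → V → ℕ
    label u v with T? (arc u v)
    ... | yes a = toℕ (lab (u , v , a))
    ... | no  _ = 0

    label-arc : ∀ u v (a : Arc u v) → label u v ≡ toℕ (lab (u , v , a))
    label-arc u v a with T? (arc u v)
    ... | yes a′ = cong (λ a → toℕ (lab (u , v , a))) (T-irrelevant a′ a)
    ... | no  ¬a = contradiction a ¬a

    label≤δ : ∀ u v → label u v ≤ δ
    label≤δ u v with T? (arc u v)
    ... | yes a = s≤s⁻¹ (Fin.toℕ<n (lab (u , v , a)))
    ... | no  _ = z≤n

    leg wait-on : V → V → ℕ → ℕ
    leg s z i     = label (route s z i) (route s z (suc i))
    wait-on s z i = wait (leg s z i) (leg s z (suc i))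

    waiting : V → V → ℕ
    waiting s z = Sum (wait-on s z) 0 (pred (dist s z))

    duration≥ : ∀ {s z} (p : TemporalPath lab s z) → dist s z + waiting s z ≤ TemporalPath.duration p
    duration≥ {s} {z} p = begin
      dist s z + waiting s z
        ≡⟨ cong (λ d → d + Sum (wait-on s z) 0 (pred d)) (path-length path) ⟨
      suc m + Sum (wait-on s z) 0 m                       ≡⟨ m+n∸m≡n (time zero) _ ⟨
      time zero + (suc m + Sum (wait-on s z) 0 m) ∸ time zero ≤⟨ ∸-monoˡ-≤ (time zero) (begin
        time zero + (suc m + Sum (wait-on s z) 0 m)       ≡⟨ regroup (time zero) m _ ⟩
        time zero + (m + Sum (wait-on s z) 0 m) + 1
          ≡⟨ cong (λ n → time zero + (n + Sum (wait-on s z) 0 n) + 1) (Fin.toℕ-fromℕ m) ⟨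
        time zero + (toℕ (fromℕ m) + Sum (wait-on s z) 0 (toℕ (fromℕ m))) + 1
          ≤⟨ +-monoˡ-≤ 1 (departs (fromℕ m)) ⟩
        time (fromℕ m) + 1                                ∎) ⟩
      time (fromℕ m) + 1 ∸ time zero                      ∎
      where
      open TemporalPath p
      open Path path using (vertex; isArc)
      open ≤-Reasoning
      regroup : ∀ t m w → t + (suc m + w) ≡ t + (m + w) + 1
      regroup = solve-∀

      time-≋ : ∀ i → time i ≋ leg s z (toℕ i)
      time-≋ i with c , eq ← active i = ≋-trans (≋-trans (≋-reflexive eq) (+-period _ c))
        (≋-reflexive (trans (sym (label-arc _ _ (isArc i)))
          (cong₂ label (trans (path-vertex path (inject₁ i)) (cong (route s z) (Fin.toℕ-inject₁ i)))
                       (path-vertex path (suc i)))))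

      departs-at : ∀ n (n≤m : n < suc m) → time zero + (n + Sum (wait-on s z) 0 n) ≤ time (fromℕ< n≤m)
      departs-at zero    _     = ≤-reflexive (+-identityʳ _)
      departs-at (suc n) n+1≤m = ≤-trans (≤-reflexive (regroup₂ (time zero) n _ _))
        (≤-trans (+-monoˡ-≤ _ (departs-at n n≤m))
          (wait-minimal (label≤δ _ _) (at-≋ n n≤m) (at-≋ (suc n) n+1≤m)
            (increasing (subst₂ _<_ (sym (Fin.toℕ-fromℕ< n≤m)) (sym (Fin.toℕ-fromℕ< n+1≤m)) ≤-refl))))
        where
        n≤m : n < suc m
        n≤m = <⇒≤ n+1≤m
        at-≋ : ∀ i (i≤m : i < suc m) → time (fromℕ< i≤m) ≋ leg s z i
        at-≋ i i≤m = ≋-trans (time-≋ (fromℕ< i≤m)) (≋-reflexive (cong (leg s z) (Fin.toℕ-fromℕ< i≤m)))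
        regroup₂ : ∀ t n w x → t + (suc n + (w + x)) ≡ t + (n + w) + suc x
        regroup₂ = solve-∀

      departs : ∀ i → time zero + (toℕ i + Sum (wait-on s z) 0 (toℕ i)) ≤ time i
      departs i = ≤-trans (departs-at (toℕ i) (Fin.toℕ<n i))
        (≤-reflexive (cong time (Fin.fromℕ<-toℕ i (Fin.toℕ<n i))))

    fastest : ∀ {s z} → s ≢ z → ∃[ p ] IsFastest lab {s} {z} p × TemporalPath.duration p ≡
      dist s z + waiting s z
    fastest {s} {z} s≢z = p , (λ q → ≤-trans (≤-reflexive duration≡) (duration≥ q)) , duration≡
      where
      m : ℕ
      m = dist (toward s z) z
      d≡1+m : dist s z ≡ suc m
      d≡1+m = dist-step s≢z

      departure : ℕ → ℕ
      departure n = leg s z 0 + (n + Sum (wait-on s z) 0 n)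

      departure-≋ : ∀ n → departure n ≋ leg s z n
      departure-≋ zero    = ≋-reflexive (+-identityʳ _)
      departure-≋ (suc n) = ≋-trans (≋-trans
        (≋-reflexive (regroup (leg s z 0) n (Sum (wait-on s z) 0 n) (wait-on s z n)))
        (≋-refl {1} ⊕ departure-≋ n ⊕ ≋-refl))
        (wait-≋ (leg s z (suc n)) (label≤δ _ _))
        where
        regroup : ∀ t n w x → t + (suc n + (w + x)) ≡ suc (t + (n + w)) + x
        regroup = solve-∀

      departure-mono : ∀ {i j} → i < j → departure i < departure j
      departure-mono {i} {j} i<j = +-monoʳ-< (leg s z 0)
        (+-mono-<-≤ i<j (Sum-monoʳ (wait-on s z) 0 (<⇒≤ i<j)))

      p : TemporalPath lab s z
      p = record
        { m          = m
        ; path       = route-path d≡1+m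
        ; time       = λ i → departure (toℕ i)
        ; active     = λ i → departure (toℕ i) / suc δ
                           , trans (m≡m%n+[m/n]*n (departure (toℕ i)) (suc δ))
                             (cong (_+ departure (toℕ i) / suc δ * suc δ)
                               (trans (≋⇒%≡ (departure-≋ (toℕ i))) (trans (m≤n⇒m%n≡m (label≤δ _ _))
                                 (trans (cong (λ n → label (route s z n)
                                   (route s z (suc (toℕ i)))) (sym (Fin.toℕ-inject₁ i)))
                                   (label-arc _ _ _)))))
        ; increasing = departure-mono
        }

      duration≡ : TemporalPath.duration p ≡ dist s z + waiting s z
      duration≡ = begin
        departure (toℕ (fromℕ m)) + 1 ∸ departure 0
          ≡⟨ cong₂ (λ i j → departure i + 1 ∸ j) (Fin.toℕ-fromℕ m) (+-identityʳ (leg s z 0)) ⟩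
        leg s z 0 + (m + Sum (wait-on s z) 0 m) + 1 ∸ leg s z 0
          ≡⟨ cong (_∸ leg s z 0) (regroup (leg s z 0) m _) ⟩
        leg s z 0 + (suc m + Sum (wait-on s z) 0 m) ∸ leg s z 0 ≡⟨ m+n∸m≡n (leg s z 0) _ ⟩
        suc m + Sum (wait-on s z) 0 m
          ≡⟨ cong (λ d → d + Sum (wait-on s z) 0 (pred d)) d≡1+m ⟨
        dist s z + waiting s z                      ∎
        where
        open ≡-Reasoning
        regroup : ∀ t m w → t + (m + w) + 1 ≡ t + (suc m + w)
        regroup = solve-∀

  module Calibrated {δ k : ℕ} (1≤k : 1 ≤ k) (tree : IsBidirectedTree) (lab₀ : Labeling (suc δ)) where
    open Timing

    -- The bounds are as tight as slack k permits while lab₀ stays valid.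
    instance-for : DiTTR (suc δ) k
    instance-for = record
      { graph    = G
      ; isTree   = tree
      ; D        = λ u v → ⌈ dist u v + (k ⊔ waiting lab₀ u v) ⌉
      ; positive = λ u v → [ ≤-trans 1≤k (≤-trans (m≤m⊔n k _) (m≤n+m _ (dist u v))) ]
      ; slack    = λ {u} {v} _ → dist u v , isDistance u v , [ +-monoʳ-≤ (dist u v) (m≤m⊔n k _) ]
      }

    calibrating-valid : DiTTR.Valid instance-for lab₀
    calibrating-valid {u} {v} u≢v with p , p-fastest , eq ← fastest lab₀ u≢v =
      p , p-fastest , [ ≤-trans (≤-reflexive eq) (+-monoʳ-≤ (dist u v) (m≤n⊔m k _)) ]

    valid⇒waiting≤ : ∀ {lab} → DiTTR.Valid instance-for lab → ∀ {u v} → u ≢ v →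
                     waiting lab u v ≤ k ⊔ waiting lab₀ u v
    valid⇒waiting≤ {lab} valid {u} {v} u≢v with p , _ , [ p≤ ] ← valid u≢v =
      +-cancelˡ-≤ (dist u v) _ _ (≤-trans (duration≥ lab p) p≤)

-- The comb

data Node : Set where
  spine tine : ℕ → Node

position : Node → ℕ
position (spine i) = i
position (tine i)  = i

data Adjacent : Node → Node → Set where
  forwards  : ∀ i → Adjacent (spine i) (spine (suc i))
  backwards : ∀ i → Adjacent (spine (suc i)) (spine i)
  outwards  : ∀ i → Adjacent (spine i) (tine i)
  inwards   : ∀ i → Adjacent (tine i) (spine i)

adjacent? : ∀ a b → Dec (Adjacent a b)
adjacent? (spine i) (spine j) with suc i ≟ j | suc j ≟ i
... | yes refl | _        = yes (forwards i)
... | no  _    | yes refl = yes (backwards j)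
... | no  1+i≢j | no 1+j≢i = no λ { (forwards _) → 1+i≢j refl ; (backwards _) → 1+j≢i refl }
adjacent? (spine i) (tine j) with i ≟ j
... | yes refl = yes (outwards i)
... | no  i≢j  = no λ { (outwards _) → i≢j refl }
adjacent? (tine i) (spine j) with i ≟ j
... | yes refl = yes (inwards i)
... | no  i≢j  = no λ { (inwards _) → i≢j refl }
adjacent? (tine i) (tine j) = no λ ()

adjacent-sym : ∀ {a b} → Adjacent a b → Adjacent b a
adjacent-sym (forwards i)  = backwards i
adjacent-sym (backwards i) = forwards i
adjacent-sym (outwards i)  = inwards i
adjacent-sym (inwards i)   = outwards i

adjacent⇒≢ : ∀ {a b} → Adjacent a b → a ≢ b
adjacent⇒≢ (forwards i)  ()
adjacent⇒≢ (backwards i) ()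
adjacent⇒≢ (outwards i)  ()
adjacent⇒≢ (inwards i)   ()

step : Node → Node → Node
step (tine i)  b = spine i
step (spine i) b with <-cmp i (position b)
... | tri< _ _ _ = spine (suc i)
... | tri≈ _ _ _ = tine i
... | tri> _ _ _ = spine (pred i)

step-< : ∀ {i} b → i < position b → step (spine i) b ≡ spine (suc i)
step-< {i} b i<b with <-cmp i (position b)
... | tri< _ _ _   = refl
... | tri≈ i≮b _ _ = contradiction i<b i≮b
... | tri> i≮b _ _ = contradiction i<b i≮b

step-≡ : ∀ {i} b → i ≡ position b → step (spine i) b ≡ tine i
step-≡ {i} b i≡b with <-cmp i (position b)
... | tri< _ i≢b _ = contradiction i≡b i≢b
... | tri≈ _ _ _   = refl
... | tri> _ i≢b _ = contradiction i≡b i≢b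

step-> : ∀ {i} b → position b < i → step (spine i) b ≡ spine (pred i)
step-> {i} b b<i with <-cmp i (position b)
... | tri< _ _ b≮i = contradiction b<i b≮i
... | tri≈ _ _ b≮i = contradiction b<i b≮i
... | tri> _ _ _   = refl

adjacent⇒step : ∀ {a b} → Adjacent a b → step a b ≡ b
adjacent⇒step (forwards i)  = step-< (spine (suc i)) ≤-refl
adjacent⇒step (backwards i) = step-> (spine i) ≤-refl
adjacent⇒step (outwards i)  = step-≡ (tine i) refl
adjacent⇒step (inwards i)   = refl

step-spine≡step-tine : ∀ i j → step (spine i) (spine j) ≡ step (spine i) (tine j)
step-spine≡step-tine i j with <-cmp i j
... | tri< _ _ _ = refl
... | tri≈ _ _ _ = refl
... | tri> _ _ _ = refl

step-along : ∀ i j → spine j ≢ spine i → spine (suc j) ≢ spine i →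
             step (spine i) (spine j) ≡ step (spine i) (spine (suc j))
step-along i j j≢i 1+j≢i with <-cmp j i
... | tri< j<i _ _ = trans (step-> (spine j) j<i)
  (sym (step-> (spine (suc j)) (≤∧≢⇒< j<i λ eq → 1+j≢i (cong spine eq))))
... | tri≈ _ j≡i _ = contradiction (cong spine j≡i) j≢i
... | tri> _ _ i<j = trans (step-< (spine j) i<j) (sym (step-< (spine (suc j)) (m<n⇒m<1+n i<j)))

step-stable : ∀ {a b c} → Adjacent b c → b ≢ a → c ≢ a → step a b ≡ step a c
step-stable {tine i}  _             _   _   = refl
step-stable {spine i} (forwards j)  b≢a c≢a = step-along i j b≢a c≢a
step-stable {spine i} (backwards j) b≢a c≢a = sym (step-along i j c≢a b≢a)
step-stable {spine i} (outwards j)  _   _   = step-spine≡step-tine i j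
step-stable {spine i} (inwards j)   _   _   = sym (step-spine≡step-tine i j)

step-adjacent : ∀ a b → Adjacent a (step a b)
step-adjacent (tine i)  b = inwards i
step-adjacent (spine i) b with <-cmp i (position b)
... | tri< _ _ _ = forwards i
... | tri≈ _ _ _ = outwards i
step-adjacent (spine (suc i)) b | tri> _ _ _ = backwards i

step-bounded : ∀ {n} a b → position a < n → position b < n → position (step a b) < n
step-bounded (tine i)  b a<n b<n = a<n
step-bounded (spine i) b a<n b<n with <-cmp i (position b)
... | tri< i<b _ _ = ≤-<-trans i<b b<n
... | tri≈ _ _ _   = a<n
... | tri> _ _ _   = ≤-<-trans pred[n]≤n a<n

distance : Node → Node → ℕ
distance (spine i) (spine j) = ∣ i - j ∣
distance (spine i) (tine j)  = suc ∣ i - j ∣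
distance (tine i)  (spine j) = suc ∣ i - j ∣
distance (tine i)  (tine j)  with i ≟ j
... | yes _ = 0
... | no  _ = 2 + ∣ i - j ∣

distance-refl : ∀ a → distance a a ≡ 0
distance-refl (spine i) = ∣n-n∣≡0 i
distance-refl (tine i) with i ≟ i
... | yes _  = refl
... | no i≢i = contradiction refl i≢i

distance-tines : ∀ {i j} → i ≢ j → distance (tine i) (tine j) ≡ 2 + ∣ i - j ∣
distance-tines {i} {j} i≢j with i ≟ j
... | yes i≡j = contradiction i≡j i≢j
... | no  _   = refl

gap-up : ∀ {i j} → i < j → ∣ i - j ∣ ≡ suc ∣ suc i - j ∣
gap-up {zero}  {suc j} _         = refl
gap-up {suc i} {suc j} (s≤s i<j) = gap-up i<j

gap-down : ∀ {i j} → j < i → ∣ i - j ∣ ≡ suc ∣ pred i - j ∣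
gap-down {suc i} {zero}  _         = cong suc (sym (∣-∣-identityʳ i))
gap-down {suc (suc i)} {suc j} (s≤s j<i) = gap-down j<i

distance-step : ∀ {a b} → a ≢ b → distance a b ≡ suc (distance (step a b) b)
distance-step {tine i}  {spine j} a≢b = refl
distance-step {tine i}  {tine j}  a≢b = distance-tines λ i≡j → a≢b (cong tine i≡j)
distance-step {spine i} {spine j} a≢b with <-cmp i j
... | tri< i<j _ _ = gap-up i<j
... | tri≈ _ i≡j _ = contradiction (cong spine i≡j) a≢b
... | tri> _ _ j<i = gap-down j<i
distance-step {spine i} {tine j}  a≢b with <-cmp i j
... | tri< i<j _ _  = cong suc (gap-up i<j)
... | tri≈ _ refl _ = cong suc (trans (∣n-n∣≡0 i) (sym (distance-refl (tine i))))
... | tri> _ _ j<i  = cong suc (gap-down j<i)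

module Comb (N : ℕ) .{{_ : NonZero N}} where

  node : Fin N × Fin 2 → Node
  node (i , 0F) = spine (toℕ i)
  node (i , 1F) = tine (toℕ i)

  decode : Fin (N * 2) → Node
  decode u = node (remQuot {N} 2 u)

  encode : Node → Fin (N * 2)
  encode (spine i) = combine (i mod N) 0F
  encode (tine i)  = combine (i mod N) 1F

  toℕ-mod : ∀ {i} → i < N → toℕ (i mod N) ≡ i
  toℕ-mod {i} i<N = trans (Fin.toℕ-fromℕ< (m%n<n i N)) (m<n⇒m%n≡m i<N)

  mod-toℕ : ∀ i → toℕ i mod N ≡ i
  mod-toℕ i = Fin.toℕ-injective (toℕ-mod (Fin.toℕ<n i))

  encode-node : ∀ ib → encode (node ib) ≡ uncurry combine ib
  encode-node (i , 0F) = cong (λ i → combine i 0F) (mod-toℕ i)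
  encode-node (i , 1F) = cong (λ i → combine i 1F) (mod-toℕ i)

  encode-decode : ∀ u → encode (decode u) ≡ u
  encode-decode u = trans (encode-node (remQuot {N} 2 u)) (Fin.combine-remQuot {N} 2 u)

  decode-encode : ∀ a → position a < N → decode (encode a) ≡ a
  decode-encode (spine i) i<N = trans (cong node (Fin.remQuot-combine (i mod N) 0F))
    (cong spine (toℕ-mod i<N))
  decode-encode (tine i)  i<N = trans (cong node (Fin.remQuot-combine (i mod N) 1F))
    (cong tine (toℕ-mod i<N))

  decode-injective : ∀ {u v} → decode u ≡ decode v → u ≡ v
  decode-injective {u} {v} eq = trans (sym (encode-decode u))
    (trans (cong encode eq) (encode-decode v))

  node-bounded : ∀ ib → position (node ib) < N
  node-bounded (i , 0F) = Fin.toℕ<n i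
  node-bounded (i , 1F) = Fin.toℕ<n i

  decode-bounded : ∀ u → position (decode u) < N
  decode-bounded u = node-bounded (remQuot {N} 2 u)

  comb : Digraph
  comb = record
    { order = N * 2
    ; arc   = λ u v → ⌊ adjacent? (decode u) (decode v) ⌋
    }

  open Digraph comb

  arc⇒adjacent : ∀ {u v} → Arc u v → Adjacent (decode u) (decode v)
  arc⇒adjacent {u} {v} = toWitness {a? = adjacent? (decode u) (decode v)}

  adjacent⇒arc : ∀ {u v} → Adjacent (decode u) (decode v) → Arc u v
  adjacent⇒arc {u} {v} = fromWitness {a? = adjacent? (decode u) (decode v)}

  decode-step : ∀ u v → decode (encode (step (decode u) (decode v))) ≡ step (decode u) (decode v)
  decode-step u v = decode-encode _ (step-bounded (decode u) (decode v) (decode-bounded u)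
    (decode-bounded v))

  compass : Compass comb
  compass = record
    { toward = λ u v → encode (step (decode u) (decode v))
    ; dist   = λ u v → distance (decode u) (decode v)
    ; toward-neighbour = λ {u} {w} u→w →
        trans (cong encode (adjacent⇒step (arc⇒adjacent u→w))) (encode-decode w)
    ; toward-stable = λ z→z′ z≢u z′≢u → cong encode
        (step-stable (arc⇒adjacent z→z′) (λ eq → z≢u (decode-injective eq)) (λ eq → z′≢u (decode-injective eq)))
    ; toward-arc = λ {u} {z} _ → adjacent⇒arc (subst (Adjacent (decode u)) (sym (decode-step u z))
      (step-adjacent (decode u) (decode z)))
    ; dist-refl  = λ z → distance-refl (decode z)
    ; dist-step  = λ {u} {z} u≢z → trans (distance-step (λ eq → u≢z (decode-injective eq)))
        (cong (λ a → suc (distance a (decode z))) (sym (decode-step u z)))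
    }

  open Compass compass

  tree : IsBidirectedTree
  tree = isBidirectedTree (λ u→v → adjacent⇒arc (adjacent-sym (arc⇒adjacent u→v)))
    (λ u≡v u→v → adjacent⇒≢ (arc⇒adjacent u→v) (cong decode u≡v)) (encode (spine 0))

  toward-encode : ∀ a b → position a < N → position b < N →
    toward (encode a) (encode b) ≡ encode (step a b)
  toward-encode a b a<N b<N = cong encode (cong₂ step (decode-encode a a<N) (decode-encode b b<N))

  encode-arc : ∀ {a b} → position a < N → position b < N → Adjacent a b → Arc (encode a) (encode b)
  encode-arc {a} {b} a<N b<N a→b = adjacent⇒arc
    (subst₂ Adjacent (sym (decode-encode a a<N)) (sym (decode-encode b b<N)) a→b)

  encode-injective : ∀ {a b} → position a < N → position b < N → encode a ≡ encode b → a ≡ b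
  encode-injective {a} {b} a<N b<N eq = trans (sym (decode-encode a a<N))
    (trans (cong decode eq) (decode-encode b b<N))

  module _ {i n : ℕ} (j<N : suc (i + n) < N) where
    private
      j : ℕ
      j = suc (i + n)
      i<j : i < j
      i<j = s≤s (m≤m+n i n)

    route-up : ∀ l → l ≤ suc n → route (encode (tine i)) (encode (tine j)) (suc l) ≡
      encode (spine (i + l))
    route-up zero    _   = trans (toward-encode (tine i) (tine j) (<-trans i<j j<N) j<N)
      (cong (λ c → encode (spine c)) (sym (+-identityʳ i)))
    route-up (suc l) l<n = begin
      toward (route (encode (tine i)) (encode (tine j)) (suc l)) (encode (tine j))
        ≡⟨ cong (λ u → toward u (encode (tine j))) (route-up l (<⇒≤ l<n)) ⟩
      toward (encode (spine (i + l))) (encode (tine j))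
        ≡⟨ toward-encode (spine (i + l)) (tine j) (<-trans i+l<j j<N) j<N ⟩
      encode (step (spine (i + l)) (tine j))            ≡⟨ cong encode (step-< (tine j) i+l<j) ⟩
      encode (spine (suc (i + l)))                      ≡⟨ cong (λ c → encode (spine c))
        (sym (+-suc i l)) ⟩
      encode (spine (i + suc l))                        ∎
      where
      open ≡-Reasoning
      i+l<j : i + l < j
      i+l<j = s≤s (+-monoʳ-≤ i (s≤s⁻¹ l<n))

    route-up-end : route (encode (tine i)) (encode (tine j)) (3 + n) ≡ encode (tine j)
    route-up-end = trans (cong (λ u → toward u (encode (tine j)))
      (trans (route-up (suc n) ≤-refl) (cong (λ c → encode (spine c)) (+-suc i n))))
      (trans (toward-encode (spine j) (tine j) j<N j<N) (cong encode (step-≡ (tine j) refl)))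

    route-down : ∀ l m → l + m ≡ suc n → route (encode (tine j)) (encode (tine i)) (suc l) ≡
      encode (spine (i + m))
    route-down zero    m refl = trans (toward-encode (tine j) (tine i) j<N (<-trans i<j j<N))
      (cong (λ c → encode (spine c)) (sym (+-suc i n)))
    route-down (suc l) m eq = begin
      toward (route (encode (tine j)) (encode (tine i)) (suc l)) (encode (tine i))
        ≡⟨ cong (λ u → toward u (encode (tine i))) (route-down l (suc m) (trans (+-suc l m) eq)) ⟩
      toward (encode (spine (i + suc m))) (encode (tine i))
        ≡⟨ toward-encode (spine (i + suc m)) (tine i) (≤-<-trans i+1+m≤j j<N) (<-trans i<j j<N) ⟩
      encode (step (spine (i + suc m)) (tine i))            ≡⟨ cong encode
        (step-> (tine i) (m<m+n i (s≤s z≤n))) ⟩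
      encode (spine (pred (i + suc m)))                     ≡⟨ cong (λ c →
        encode (spine (pred c))) (+-suc i m) ⟩
      encode (spine (i + m))                                ∎
      where
      open ≡-Reasoning
      i+1+m≤j : i + suc m ≤ j
      i+1+m≤j = ≤-trans (≤-reflexive (+-suc i m))
        (s≤s (+-monoʳ-≤ i (m+n≤o⇒n≤o l (≤-reflexive (suc-injective eq)))))

    route-down-end : route (encode (tine j)) (encode (tine i)) (3 + n) ≡ encode (tine i)
    route-down-end = trans (cong (λ u → toward u (encode (tine i)))
      (trans (route-down (suc n) 0 (+-identityʳ _)) (cong (λ c → encode (spine c)) (+-identityʳ i))))
      (trans (toward-encode (spine i) (tine i) (<-trans i<j j<N) (<-trans i<j j<N))
        (cong encode (step-≡ (tine i) refl)))

    dist-tines : dist (encode (tine i)) (encode (tine j)) ≡ 3 + n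
    dist-tines = trans (cong₂ distance (decode-encode (tine i) (<-trans i<j j<N))
      (decode-encode (tine j) j<N))
      (trans (distance-tines (<⇒≢ i<j)) (cong (2 +_) (trans (cong (∣ i -_∣) (sym (+-suc i n)))
        (∣m-m+n∣≡n i (suc n)))))

    dist-tines′ : dist (encode (tine j)) (encode (tine i)) ≡ 3 + n
    dist-tines′ = trans (cong₂ distance (decode-encode (tine j) j<N)
      (decode-encode (tine i) (<-trans i<j j<N)))
      (trans (distance-tines (≢-sym (<⇒≢ i<j))) (cong (2 +_) (trans (∣-∣-comm j i)
        (trans (cong (∣ i -_∣) (sym (+-suc i n))) (∣m-m+n∣≡n i (suc n))))))

  module CombTiming {δ : ℕ} (lab : Labeling (suc δ)) where
    open Timing lab
    open Congruence δ

    labels : CombLabels δ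
    labels = record
      { forth     = λ i → label (encode (spine i)) (encode (spine (suc i)))
      ; back      = λ i → label (encode (spine (suc i))) (encode (spine i))
      ; inward    = λ i → label (encode (tine i)) (encode (spine i))
      ; outward   = λ i → label (encode (spine i)) (encode (tine i))
      ; forth≤δ   = λ i → label≤δ _ _
      ; back≤δ    = λ i → label≤δ _ _
      ; inward≤δ  = λ i → label≤δ _ _
      }
    open CombLabels labels

    private
      turn-at : Fin (N * 2) → Fin (N * 2) → Fin (N * 2) → ℕ
      turn-at u v w = wait (label u v) (label v w)

      Sum-ends : ∀ f n {m} → Sum f 1 n ≡ m → Sum f 0 (2 + n) ≡ f 0 + m + f (suc n)
      Sum-ends f n eq = cong (_+ f (suc n)) (trans (Sum-head f 0 n) (cong (f 0 +_) eq))

      turn-at-cong : ∀ {u u′ v v′ w w′} → u ≡ u′ → v ≡ v′ → w ≡ w′ → turn-at u v w ≡ turn-at u′ v′ w′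
      turn-at-cong refl refl refl = refl

      spine≡ : ∀ {i j} → i ≡ j → encode (spine i) ≡ encode (spine j)
      spine≡ = cong (λ i → encode (spine i))

    waiting-up : ∀ i n → suc (i + n) < N → waiting (encode (tine i)) (encode (tine (suc (i + n)))) ≡
                 enter-forth i + Sum forth-wait (suc i) n + exit-forth (suc (i + n))
    waiting-up i n j<N = trans (cong (λ d → Sum (wait-on s z) 0 (pred d)) (dist-tines j<N))
      (trans (Sum-ends (wait-on s z) n (Sum-cong 1 (suc i) n along))
        (cong₂ (λ a b → a + Sum forth-wait (suc i) n + b) enter exit))
      where
      s = encode (tine i)
      z = encode (tine (suc (i + n)))
      along : ∀ l → l < n → wait-on s z (suc l) ≡ forth-wait (suc i + l)
      along l l<n = turn-at-cong
        (route-up j<N l (m≤n⇒m≤1+n (<⇒≤ l<n)))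
        (trans (route-up j<N (suc l) (m≤n⇒m≤1+n l<n)) (spine≡ (+-suc i l)))
        (trans (route-up j<N (2 + l) (s≤s l<n))
          (spine≡ (trans (+-suc i (suc l)) (cong suc (+-suc i l)))))
      enter : wait-on s z 0 ≡ enter-forth i
      enter = turn-at-cong {u = s} refl
        (trans (route-up j<N 0 z≤n) (spine≡ (+-identityʳ i)))
        (trans (route-up j<N 1 (s≤s z≤n)) (spine≡ (+-comm i 1)))
      exit : wait-on s z (suc n) ≡ exit-forth (suc (i + n))
      exit = turn-at-cong (route-up j<N n (n≤1+n n))
        (trans (route-up j<N (suc n) ≤-refl) (spine≡ (+-suc i n))) (route-up-end {i} {n} j<N)

    waiting-down : ∀ i n → suc (i + n) < N → waiting (encode (tine (suc (i + n)))) (encode (tine i)) ≡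
                   exit-back i + Sum back-wait (suc i) n + enter-back (suc (i + n))
    waiting-down i n j<N = trans (cong (λ d → Sum (wait-on s z) 0 (pred d)) (dist-tines′ j<N))
      (trans (Sum-ends (wait-on s z) n (Sum-reverse 1 (suc i) n along))
        (trans (cong₂ (λ a b → a + Sum back-wait (suc i) n + b) enter exit)
          (swap (enter-back (suc (i + n))) (Sum back-wait (suc i) n) (exit-back i))))
      where
      s = encode (tine (suc (i + n)))
      z = encode (tine i)
      swap : ∀ a b c → a + b + c ≡ c + b + a
      swap = solve-∀
      along : ∀ l m → suc (l + m) ≡ n → wait-on s z (suc l) ≡ back-wait (suc i + m)
      along l m eq = turn-at-cong
        (trans (route-down j<N l (2 + m)
          (trans (+-suc l (suc m)) (cong suc (trans (+-suc l m) eq))))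
            (spine≡ (trans (+-suc i (suc m)) (cong suc (+-suc i m)))))
        (trans (route-down j<N (suc l) (suc m) (cong suc (trans (+-suc l m) eq)))
          (spine≡ (+-suc i m)))
        (route-down j<N (2 + l) m (cong suc eq))
      enter : wait-on s z 0 ≡ enter-back (suc (i + n))
      enter = turn-at-cong {u = s} refl
        (trans (route-down j<N 0 (suc n) refl) (spine≡ (+-suc i n)))
        (route-down j<N 1 n refl)
      exit : wait-on s z (suc n) ≡ exit-back i
      exit = turn-at-cong (trans (route-down j<N n 1 (+-comm n 1)) (spine≡ (+-comm i 1)))
        (trans (route-down j<N (suc n) 0 (+-identityʳ (suc n))) (spine≡ (+-identityʳ i)))
          (route-down-end {i} {n} j<N)

-- The intended labelling

module Gadget (η k : ℕ) (1≤k : 1 ≤ k) (k<δ : k < η * 2) where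
  open Layout η k
  open Comb order
  open Compass compass

  block : ℕ → ℕ
  block i = i / block-length

  residue : ℕ → ℕ
  residue i = phase i % suc δ

  -- In the intended labelling the turn at position i is carried either by the
  -- waits of the paths from the tine forwards and to the tine backwards
  -- (`ahead`), or by those of the other two paths at the tine (`behind`).
  ahead behind : ℕ → ℕ
  ahead i with residue i ≤? block i
  ... | yes _ = residue i
  ... | no  _ = 0
  behind i with residue i ≤? block i
  ... | yes _ = 0
  ... | no  _ = suc δ ∸ residue i

  Hub : ℕ → Set
  Hub i = behind i ≤ k ∸ block i

  residue≤δ : ∀ i → residue i ≤ δ
  residue≤δ i = s≤s⁻¹ (m%n<n (phase i) (suc δ))

  ahead≤block : ∀ i → ahead i ≤ block i
  ahead≤block i with residue i ≤? block i
  ... | yes r≤b = r≤b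
  ... | no  _   = z≤n

  ahead≤δ : ∀ i → ahead i ≤ δ
  ahead≤δ i with residue i ≤? block i
  ... | yes _ = residue≤δ i
  ... | no  _ = z≤n

  behind≤δ : ∀ i → behind i ≤ δ
  behind≤δ i with residue i ≤? block i
  ... | yes _   = z≤n
  ... | no  r≰b = ∸-monoʳ-≤ (suc δ) (≤-trans (s≤s z≤n) (≰⇒> r≰b))

  behind+phase : ∀ i → behind i + phase i ≋ ahead i
  behind+phase i with residue i ≤? block i
  ... | yes _ = ≋-sym (%-≋ (phase i))
  ... | no  _ = ≋-trans (≋-refl {suc δ ∸ residue i} ⊕ ≋-sym (%-≋ (phase i)))
    (≋-trans (≋-reflexive (trans (m∸n+n≡m (m≤n⇒m≤1+n (residue≤δ i))) (sym (+-identityʳ (suc δ)))))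
      (+-period 0 1))

  hub : ∀ {b i m} → b ≤ k → m ≤ k → InBlock b i → phase i + k ≋ b + m → Hub i
  hub {b} {i} {m} b≤k m≤k i∈b i≋ with residue i ≤? block i
  ... | yes _   = z≤n
  ... | no  r≰b = subst (λ c → suc δ ∸ residue i ≤ k ∸ c) (sym block≡b)
      (m≤n+o⇒m∸n≤o (suc δ) (residue i) (≰⇒> λ small → <⇒≱ b<r (+-cancelʳ-≤ (k ∸ b) _ _ (begin
        residue i + (k ∸ b) ≡⟨ ≋⇒≡ small (≤-trans m≤k (<⇒≤ k<δ)) wrapped ⟩
        m                   ≤⟨ m≤k ⟩
        k                   ≡⟨ m+[n∸m]≡n b≤k ⟨
        b + (k ∸ b)         ∎))))
    where
    open ≤-Reasoning
    block≡b : block i ≡ b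
    block≡b = ≤-antisym (s≤s⁻¹ (m<n*o⇒m/o<n (InBlock.upper i∈b)))
      (≤-trans (≤-reflexive (sym (m*n/n≡m b block-length)))
        (/-monoˡ-≤ block-length (InBlock.lower i∈b)))
    b<r : b < residue i
    b<r = subst (_< residue i) block≡b (≰⇒> r≰b)
    wrapped : residue i + (k ∸ b) ≋ m
    wrapped = +-cancelˡ-≋ b (≋-trans (≋-reflexive
      (trans (regroup b (residue i) (k ∸ b)) (cong (residue i +_) (m+[n∸m]≡n b≤k))))
      (≋-trans (%-≋ (phase i) ⊕ ≋-refl {k}) i≋))
      where
      regroup : ∀ b r d → b + (r + d) ≡ r + (b + d)
      regroup = solve-∀

  intended : Node → Node → ℕ
  intended (spine i) (spine j) with i <? j
  ... | yes _ = i
  ... | no  _ = j * δ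
  intended (spine i) (tine j) = i + behind i
  intended (tine i)  _        = i + (δ ∸ ahead i)

  intended-forth : ∀ i → intended (spine i) (spine (suc i)) ≡ i
  intended-forth i with i <? suc i
  ... | yes _ = refl
  ... | no i≮ = contradiction ≤-refl i≮

  intended-back : ∀ i → intended (spine (suc i)) (spine i) ≡ i * δ
  intended-back i with suc i <? i
  ... | yes i< = contradiction (<-trans i< ≤-refl) (<-irrefl refl)
  ... | no _   = refl

  lab₀ : Digraph.Labeling comb (suc δ)
  lab₀ (u , v , _) = intended (decode u) (decode v) mod suc δ

  module Intended where
    open Timing lab₀
    open CombTiming lab₀
    open CombLabels labels

    label-≋ : ∀ {a b} → position a < order → position b < order → Adjacent a b →
              label (encode a) (encode b) ≋ intended a b
    label-≋ {a} {b} a<N b<N a→b = ≋-trans (≋-reflexive (trans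
      (label-arc (encode a) (encode b) (encode-arc a<N b<N a→b))
      (trans (Fin.toℕ-fromℕ< _) (cong₂ (λ a b → intended a b % suc δ) (decode-encode a a<N)
        (decode-encode b b<N)))))
      (%-≋ (intended a b))

    forth-≋ : ∀ i → suc i < order → forth i ≋ i
    forth-≋ i i<N = ≋-trans (label-≋ (<⇒≤ i<N) i<N (forwards i)) (≋-reflexive (intended-forth i))

    back-≋ : ∀ i → suc i < order → back i ≋ i * δ
    back-≋ i i<N = ≋-trans (label-≋ i<N (<⇒≤ i<N) (backwards i)) (≋-reflexive (intended-back i))

    outward-≋ : ∀ i → i < order → outward i ≋ i + behind i
    outward-≋ i i<N = label-≋ i<N i<N (outwards i)

    inward-≋ : ∀ i → i < order → inward i + ahead i ≋ i + δ
    inward-≋ i i<N = ≋-trans (label-≋ i<N i<N (inwards i) ⊕ ≋-refl {ahead i})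
      (≋-reflexive (trans (+-assoc i _ _) (cong (i +_) (m∸n+n≡m (ahead≤δ i)))))

    forth-wait≡0 : ∀ i → suc (suc i) < order → forth-wait (suc i) ≡ 0
    forth-wait≡0 i i<N = wait-unique (forth≤δ i) z≤n (≋-trans
      (≋-refl {1} ⊕ (forth-≋ i (<⇒≤ i<N) ⊕ ≋-refl {0}))
      (≋-trans (≋-reflexive (cong suc (+-identityʳ i))) (≋-sym (forth-≋ (suc i) i<N))))

    back-wait≡0 : ∀ i → suc (suc i) < order → back-wait (suc i) ≡ 0
    back-wait≡0 i i<N = wait-unique (back≤δ (suc i)) z≤n (≋-trans
      (≋-refl {1} ⊕ (back-≋ (suc i) i<N ⊕ ≋-refl {0}))
      (≋-trans (≋-trans (≋-reflexive (regroup i δ)) (+-period (i * δ) 1))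
        (≋-sym (back-≋ i (<⇒≤ i<N)))))
      where
      regroup : ∀ i d → suc (d + i * d + 0) ≡ i * d + 1 * suc d
      regroup = solve-∀

    enter-forth≡ahead : ∀ i → suc i < order → enter-forth i ≡ ahead i
    enter-forth≡ahead i i<N = wait-unique (inward≤δ i) (ahead≤δ i) (≋-trans
      (≋-refl {1} ⊕ inward-≋ i (<⇒≤ i<N))
      (≋-trans (≋-trans (≋-reflexive (regroup i δ)) (+-period i 1)) (≋-sym (forth-≋ i i<N))))
      where
      regroup : ∀ i d → suc (i + d) ≡ i + 1 * suc d
      regroup = solve-∀

    exit-back≡ahead : ∀ i → suc i < order → exit-back i ≡ ahead i
    exit-back≡ahead i i<N = wait-unique (back≤δ i) (ahead≤δ i) (≋-trans
      (≋-refl {1} ⊕ (back-≋ i i<N ⊕ ≋-sym (behind+phase i)))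
      (≋-trans (≋-trans (≋-reflexive (regroup i δ (behind i))) (+-period (i + behind i) (suc i)))
        (≋-sym (outward-≋ i (<⇒≤ i<N)))))
      where
      regroup : ∀ i d s → suc (i * d + (s + (i * 2 + d))) ≡ i + s + suc i * suc d
      regroup = solve-∀

    exit-forth≡behind : ∀ i → suc i < order → exit-forth (suc i) ≡ behind (suc i)
    exit-forth≡behind i i<N = wait-unique (forth≤δ i) (behind≤δ (suc i)) (≋-trans
      (≋-refl {1} ⊕ (forth-≋ i i<N ⊕ ≋-refl {behind (suc i)}))
      (≋-sym (outward-≋ (suc i) i<N)))

    enter-back≡behind : ∀ i → suc i < order → enter-back (suc i) ≡ behind (suc i)
    enter-back≡behind i i<N = wait-unique (inward≤δ (suc i)) (behind≤δ (suc i))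
      (≋-by (inward-≋ (suc i) i<N ⊕ ≋-sym (back-≋ i i<N) ⊕ behind+phase (suc i) ⊕ ≋-sym
        (+-period 0 i))
        (regroup i δ (behind (suc i)) (inward (suc i)) (ahead (suc i)) (back i)))
      where
      regroup : ∀ i d s a t r → suc i + d + r + t + (0 + i * suc d) + suc (a + s) ≡
                                a + t + i * d + (s + (suc i * 2 + d)) + 0 + r
      regroup = solve-∀

    silent : ∀ f → (∀ i → suc (suc i) < order → f (suc i) ≡ 0) → ∀ i n → suc (i + n) < order →
      Sum f (suc i) n ≡ 0
    silent f f≡0 i n j<N = Sum-zero (suc i) n λ l l<n →
      f≡0 (i + l) (≤-<-trans (s≤s (≤-trans (≤-reflexive (sym (+-suc i l))) (+-monoʳ-≤ i l<n))) j<N)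

    hubs-fit : ∀ i n → Hub (suc (i + n)) → suc (i + n) < order →
      ahead i + 0 + behind (suc (i + n)) ≤ k
    hubs-fit i n hⱼ j<N = begin
      ahead i + 0 + behind j             ≡⟨ cong (_+ behind j) (+-identityʳ (ahead i)) ⟩
      ahead i + behind j                 ≤⟨ +-mono-≤
        (≤-trans (ahead≤block i) (/-monoˡ-≤ block-length (m≤n⇒m≤1+n (m≤m+n i n)))) hⱼ ⟩
      block j + (k ∸ block j)            ≡⟨ m+[n∸m]≡n (s≤s⁻¹ (m<n*o⇒m/o<n j<N)) ⟩
      k                                  ∎
      where
      open ≤-Reasoning
      j = suc (i + n)

    waiting-up≤k : ∀ i n → Hub (suc (i + n)) → suc (i + n) < order →
                   waiting (encode (tine i)) (encode (tine (suc (i + n)))) ≤ k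
    waiting-up≤k i n hⱼ j<N = ≤-trans (≤-reflexive (trans (waiting-up i n j<N)
      (cong₂ _+_ (cong₂ _+_ (enter-forth≡ahead i (≤-<-trans (s≤s (m≤m+n i n)) j<N))
        (silent forth-wait forth-wait≡0 i n j<N))
        (exit-forth≡behind (i + n) j<N)))) (hubs-fit i n hⱼ j<N)

    waiting-down≤k : ∀ i n → Hub (suc (i + n)) → suc (i + n) < order →
                     waiting (encode (tine (suc (i + n)))) (encode (tine i)) ≤ k
    waiting-down≤k i n hⱼ j<N = ≤-trans (≤-reflexive (trans (waiting-down i n j<N)
      (cong₂ _+_ (cong₂ _+_ (exit-back≡ahead i (≤-<-trans (s≤s (m≤m+n i n)) j<N))
        (silent back-wait back-wait≡0 i n j<N))
        (enter-back≡behind (i + n) j<N)))) (hubs-fit i n hⱼ j<N)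

  open Calibrated 1≤k tree lab₀

  module _ (lab : Digraph.Labeling comb (suc δ)) (valid : DiTTR.Valid instance-for lab) where
    open Timing
    open CombTiming lab
    open CombLabels labels

    budget : ∀ i n → Hub i → Hub (suc (i + n)) → suc (i + n) < order →
             enter-forth i + Sum forth-wait (suc i) n + exit-forth (suc (i + n)) ≤ k ×
             exit-back i + Sum back-wait (suc i) n + enter-back (suc (i + n)) ≤ k
    budget i n _ hⱼ j<N =
        subst (_≤ k) (waiting-up i n j<N) (tight tines≢ (Intended.waiting-up≤k i n hⱼ j<N))
      , subst (_≤ k) (waiting-down i n j<N)
        (tight (≢-sym tines≢) (Intended.waiting-down≤k i n hⱼ j<N))
      where
      i<j : i < suc (i + n)
      i<j = s≤s (m≤m+n i n)
      tines≢ : encode (tine i) ≢ encode (tine (suc (i + n)))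
      tines≢ eq = <⇒≢ i<j (cong position
        (encode-injective {tine i} {tine _} (<-trans i<j j<N) j<N eq))
      tight : ∀ {u v} → u ≢ v → waiting lab₀ u v ≤ k → waiting lab u v ≤ k
      tight u≢v w₀≤k = ≤-trans (valid⇒waiting≤ valid u≢v) (⊔-lub ≤-refl w₀≤k)

    equal-labels : label lab (encode (spine block-length)) (encode (spine (suc block-length))) ≡
                   label lab (encode (spine (suc block-length))) (encode (spine block-length))
    equal-labels = forth≡back 1≤k k<δ labels Hub hub budget

  B+1<order : suc block-length < order
  B+1<order = begin-strict
    1 + block-length            <⟨ ≤-refl ⟩
    2 + block-length            ≤⟨ +-monoˡ-≤ block-length 2≤B ⟩
    block-length + block-length ≡⟨ cong (block-length +_) (+-identityʳ block-length) ⟨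
    2 * block-length            ≤⟨ *-monoˡ-≤ block-length (s≤s 1≤k) ⟩
    order                       ∎
    where
    open ≤-Reasoning
    2≤B : 2 ≤ block-length
    2≤B = ≤-trans (s≤s (≤-trans (s≤s z≤n) k<δ)) (m≤m+n (suc δ) _)

  gadget : Σ[ I ∈ DiTTR (suc δ) k ] (let open DiTTR I in
    Realizable × (∃[ v₁ ] ∃[ v₂ ] Σ[ a ∈ Arc v₁ v₂ ] EnforcesEqual (v₁ , v₂ , a)
      (v₂ , v₁ , symmetric a)))
  gadget = instance-for , (lab₀ , calibrating-valid) , v₁ , v₂ , a ,
    λ lab valid → Fin.toℕ-injective (trans (sym (Timing.label-arc lab v₁ v₂ a))
      (trans (equal-labels lab valid) (Timing.label-arc lab v₂ v₁ _)))
    where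
    v₁ = encode (spine block-length)
    v₂ = encode (spine (suc block-length))
    a = encode-arc (<⇒≤ B+1<order) B+1<order (forwards block-length)

lemma17 : ∀ (Δ k : ℕ) → 1 ≤ k → k + 2 ≤ Δ → 2 ∤ Δ →
    Σ[ I ∈ DiTTR Δ k ] (let open DiTTR I in
    Realizable ×
    (∃[ v₁ ] ∃[ v₂ ] Σ[ a ∈ Arc v₁ v₂ ]
    EnforcesEqual (v₁ , v₂ , a) (v₂ , v₁ , symmetric a)))
lemma17 Δ k 1≤k k+2≤Δ 2∤Δ with Δ % 2 in r | m%n<n Δ 2
... | 0           | _            = contradiction (m%n≡0⇒n∣m Δ 2 r) 2∤Δ
... | suc (suc _) | s≤s (s≤s ())
... | 1           | _            = subst Goal (sym odd) (Gadget.gadget (Δ / 2) k 1≤k k<δ)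
  where
  Goal : ℕ → Set
  Goal Δ = Σ[ I ∈ DiTTR Δ k ] (let open DiTTR I in
    Realizable × (∃[ v₁ ] ∃[ v₂ ] Σ[ a ∈ Arc v₁ v₂ ] EnforcesEqual (v₁ , v₂ , a)
      (v₂ , v₁ , symmetric a)))
  odd : Δ ≡ suc (Δ / 2 * 2)
  odd = trans (m≡m%n+[m/n]*n Δ 2) (cong (_+ Δ / 2 * 2) r)
  k<δ : k < Δ / 2 * 2
  k<δ = s≤s⁻¹ (subst₂ _≤_ (+-comm k 2) odd k+2≤Δ)
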